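{- For each $n\ge 1$, $$R_n\cong R_n/J_n\otimes \mathrm{Sym}_{R_n}$$ as an algebra. That is, $R_n$ is free over $\mathrm{Sym}_{R_n}$.
   Context: Let $R_n=\mathbb{Q}[\theta_1,\dots,\theta_n]$ be the polynomial ring in anticommuting variables over $\mathbb{Q}$ (isomorphic to the exterior algebra of a vector space of dimension $n$): $\theta_i\theta_j=-\theta_j\theta_i$ for $i\ne j$ and $\theta_i^2=0$, graded by degree. The symmetric group $\mathcal{S}_n$ acts on $R_n$ by permuting the variables; $\mathrm{Sym}_{R_n}$ is the ring of symmetric invariants of $R_n$, which has linear basis $\{1,F_1\}$ with $F_1=\theta_1+\theta_2+\cdots+\theta_n$. $J_n$ is the ideal of $R_n$ generated by the symmetric invariants of non-zero degree, i.e. the ideal generated by $F_1$. The symbol $\otimes$ denotes tensor product over $\mathbb{Q}$. -}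

module Defs where

open import Level using (0ℓ)
open import Algebra.Bundles using (Ring; AbelianGroup; Monoid)
open import Algebra.Structures using (IsAbelianGroup)
open import Algebra.Module.Bundles using (LeftModule)
open import Algebra.Morphism.Structures
  using (IsRingHomomorphism; IsRingMonomorphism; IsRingIsomorphism)
import Algebra.Definitions.RawMonoid as Sum
import Algebra.Morphism.RingMonomorphism as RingMono
import Algebra.Properties.CommutativeSemigroup as CommSemigroup
import Algebra.Properties.Ring as RingProperties
open import Data.Fin.Base using (Fin)
open import Data.Fin.Permutation using (Permutation′; _⟨$⟩ʳ_; _⟨$⟩ˡ_; inverseˡ)
open import Data.Nat.Base as ℕ using (ℕ)
open import Data.Parity.Base as ℙ using (Parity; 0ℙ; 1ℙ)
open import Data.Parity.Properties using (+-homo-+)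
open import Data.Product.Base using (Σ; ∃; _×_; _,_; proj₁; proj₂)
open import Data.Rational.Base as ℚ using (ℚ; 0ℚ; 1ℚ)
import Data.Rational.Properties as ℚ
open import Function.Definitions using (Injective)
open import Relation.Binary.PropositionalEquality as ≡ using (_≡_; _≢_)
import Relation.Binary.Reasoning.Setoid as SetoidReasoning

-- A ring with a central ring homomorphism from ℚ.
record Algebra : Set₁ where
  field
    ring : Ring 0ℓ 0ℓ
  open Ring ring public
  field
    ι                    : ℚ → Carrier
    ι-isRingHomomorphism : IsRingHomomorphism ℚ.+-*-rawRing rawRing ι
    ι-central            : ∀ q x → ι q * x ≈ x * ι q

  module ι = IsRingHomomorphism ι-isRingHomomorphism

infix 4 _≅_

record _≅_ (A B : Algebra) : Set where
  private
    module A = Algebra A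
    module B = Algebra B
  field
    to                : A.Carrier → B.Carrier
    isRingIsomorphism : IsRingIsomorphism A.rawRing B.rawRing to
    ι-homo            : ∀ q → to (A.ι q) B.≈ B.ι q

-- A ℤ/2-graded ℚ-algebra, the grading being given by the projections onto the
-- even (0ℙ) and the odd (1ℙ) part.
record Superalgebra : Set₁ where
  field
    algebra : Algebra
  open Algebra algebra public
  field
    part          : Parity → Carrier → Carrier
    part-cong     : ∀ p {x y} → x ≈ y → part p x ≈ part p y
    part-+        : ∀ p x y → part p (x + y) ≈ part p x + part p y
    part-*        : ∀ p x y → part p (x * y) ≈
                      part 0ℙ x * part p y + part 1ℙ x * part (p ℙ.⁻¹) y
    part-ι        : ∀ q → part 0ℙ (ι q) ≈ ι q
    part-sum      : ∀ x → part 0ℙ x + part 1ℙ x ≈ x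
    part-disjoint : ∀ p x → part (p ℙ.⁻¹) (part p x) ≈ 0#

  open RingProperties ring public
  open CommSemigroup +-commutativeSemigroup public using (interchange)

  part-0 : ∀ p → part p 0# ≈ 0#
  part-0 p = +-cancelˡ (part p 0#) _ _ (begin
    part p 0# + part p 0# ≈⟨ part-+ p 0# 0# ⟨
    part p (0# + 0#)      ≈⟨ part-cong p (+-identityʳ 0#) ⟩
    part p 0#             ≈⟨ +-identityʳ _ ⟨
    part p 0# + 0#        ∎)
    where open SetoidReasoning setoid

  part-‿ : ∀ p x → part p (- x) ≈ - part p x
  part-‿ p x = +-cancelˡ (part p x) _ _ (begin
    part p x + part p (- x) ≈⟨ part-+ p x (- x) ⟨
    part p (x + - x)        ≈⟨ part-cong p (-‿inverseʳ x) ⟩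
    part p 0#               ≈⟨ part-0 p ⟩
    0#                      ≈⟨ -‿inverseʳ _ ⟨
    part p x + - part p x   ∎)
    where open SetoidReasoning setoid

  part-ι-odd : ∀ q → part 1ℙ (ι q) ≈ 0#
  part-ι-odd q = +-cancelˡ (ι q) _ _ (begin
    ι q + part 1ℙ (ι q)            ≈⟨ +-congʳ (part-ι q) ⟨
    part 0ℙ (ι q) + part 1ℙ (ι q)  ≈⟨ part-sum (ι q) ⟩
    ι q                            ≈⟨ +-identityʳ _ ⟨
    ι q + 0#                       ∎)
    where open SetoidReasoning setoid

  part-idem : ∀ p x → part p (part p x) ≈ part p x
  part-idem 0ℙ x = begin
    part 0ℙ (part 0ℙ x)                       ≈⟨ +-identityʳ _ ⟨
    part 0ℙ (part 0ℙ x) + 0#                  ≈⟨ +-congˡ (part-disjoint 0ℙ x) ⟨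
    part 0ℙ (part 0ℙ x) + part 1ℙ (part 0ℙ x) ≈⟨ part-sum _ ⟩
    part 0ℙ x                                 ∎
    where open SetoidReasoning setoid
  part-idem 1ℙ x = begin
    part 1ℙ (part 1ℙ x)                       ≈⟨ +-identityˡ _ ⟨
    0# + part 1ℙ (part 1ℙ x)                  ≈⟨ +-congʳ (part-disjoint 1ℙ x) ⟨
    part 0ℙ (part 1ℙ x) + part 1ℙ (part 1ℙ x) ≈⟨ part-sum _ ⟩
    part 1ℙ x                                 ∎
    where open SetoidReasoning setoid

  -- The sign (-1)^(|p||x|), extended linearly in x.
  sign : Parity → Carrier → Carrier
  sign 0ℙ x = x
  sign 1ℙ x = part 0ℙ x + - part 1ℙ x

  sign-cong : ∀ p {x y} → x ≈ y → sign p x ≈ sign p y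
  sign-cong 0ℙ e = e
  sign-cong 1ℙ e = +-cong (part-cong 0ℙ e) (-‿cong (part-cong 1ℙ e))

  sign-+ : ∀ p x y → sign p (x + y) ≈ sign p x + sign p y
  sign-+ 0ℙ x y = refl
  sign-+ 1ℙ x y = begin
    part 0ℙ (x + y) + - part 1ℙ (x + y)
      ≈⟨ +-cong (part-+ 0ℙ x y) (-‿cong (part-+ 1ℙ x y)) ⟩
    (part 0ℙ x + part 0ℙ y) + - (part 1ℙ x + part 1ℙ y)
      ≈⟨ +-congˡ (-‿+-comm _ _) ⟨
    (part 0ℙ x + part 0ℙ y) + (- part 1ℙ x + - part 1ℙ y)
      ≈⟨ interchange _ _ _ _ ⟩
    sign 1ℙ x + sign 1ℙ y ∎
    where open SetoidReasoning setoid

  sign-ι : ∀ p q → sign p (ι q) ≈ ι q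
  sign-ι 0ℙ q = refl
  sign-ι 1ℙ q = begin
    part 0ℙ (ι q) + - part 1ℙ (ι q) ≈⟨ +-cong (part-ι q) (-‿cong (part-ι-odd q)) ⟩
    ι q + - 0#                      ≈⟨ +-congˡ -0#≈0# ⟩
    ι q + 0#                        ≈⟨ +-identityʳ _ ⟩
    ι q                             ∎
    where open SetoidReasoning setoid

  private
    neg-neg-* : ∀ x y → - x * - y ≈ x * y
    neg-neg-* x y = begin
      - x * - y     ≈⟨ -‿distribˡ-* x (- y) ⟨
      - (x * - y)   ≈⟨ -‿cong (-‿distribʳ-* x y) ⟨
      - - (x * y)   ≈⟨ -‿involutive (x * y) ⟩
      x * y         ∎
      where open SetoidReasoning setoid

  sign-* : ∀ p x y → sign p (x * y) ≈ sign p x * sign p y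
  sign-* 0ℙ x y = refl
  sign-* 1ℙ x y = begin
    part 0ℙ (x * y) + - part 1ℙ (x * y)
      ≈⟨ +-cong (part-* 0ℙ x y) (-‿cong (part-* 1ℙ x y)) ⟩
    (x₀ * y₀ + x₁ * y₁) + - (x₀ * y₁ + x₁ * y₀)
      ≈⟨ +-congˡ (-‿+-comm _ _) ⟨
    (x₀ * y₀ + x₁ * y₁) + (- (x₀ * y₁) + - (x₁ * y₀))
      ≈⟨ +-cong (+-congˡ (sym (neg-neg-* x₁ y₁)))
                (+-cong (-‿distribʳ-* x₀ y₁) (-‿distribˡ-* x₁ y₀)) ⟩
    (x₀ * y₀ + - x₁ * - y₁) + (x₀ * - y₁ + - x₁ * y₀)
      ≈⟨ +-congˡ (+-comm _ _) ⟩
    (x₀ * y₀ + - x₁ * - y₁) + (- x₁ * y₀ + x₀ * - y₁)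
      ≈⟨ interchange _ _ _ _ ⟩
    (x₀ * y₀ + - x₁ * y₀) + (- x₁ * - y₁ + x₀ * - y₁)
      ≈⟨ +-cong (sym (distribʳ _ _ _))
                (trans (+-comm _ _) (sym (distribʳ _ _ _))) ⟩
    sign 1ℙ x * y₀ + sign 1ℙ x * - y₁
      ≈⟨ distribˡ _ _ _ ⟨
    sign 1ℙ x * sign 1ℙ y ∎
    where
    open SetoidReasoning setoid
    x₀ = part 0ℙ x
    x₁ = part 1ℙ x
    y₀ = part 0ℙ y
    y₁ = part 1ℙ y

  sign-sign : ∀ x → sign 1ℙ (sign 1ℙ x) ≈ x
  sign-sign x = begin
    part 0ℙ (x₀ + - x₁) + - part 1ℙ (x₀ + - x₁)
      ≈⟨ +-cong (part-+ 0ℙ x₀ (- x₁)) (-‿cong (part-+ 1ℙ x₀ (- x₁))) ⟩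
    (part 0ℙ x₀ + part 0ℙ (- x₁)) + - (part 1ℙ x₀ + part 1ℙ (- x₁))
      ≈⟨ +-cong (+-cong (part-idem 0ℙ x) (part-‿ 0ℙ x₁))
                (-‿cong (+-cong (part-disjoint 0ℙ x) (part-‿ 1ℙ x₁))) ⟩
    (x₀ + - part 0ℙ x₁) + - (0# + - part 1ℙ x₁)
      ≈⟨ +-cong (+-congˡ (trans (-‿cong (part-disjoint 1ℙ x)) -0#≈0#))
                (-‿cong (trans (+-identityˡ _) (-‿cong (part-idem 1ℙ x)))) ⟩
    (x₀ + 0#) + - - x₁
      ≈⟨ +-cong (+-identityʳ _) (-‿involutive x₁) ⟩
    x₀ + x₁
      ≈⟨ part-sum x ⟩
    x ∎
    where
    open SetoidReasoning setoid
    x₀ = part 0ℙ x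
    x₁ = part 1ℙ x

-- The tensor product over ℚ, with the Koszul sign rule for the multiplication.
-- With the unsigned multiplication, ℚ[θ₁] ⊗ ℚ[θ₁] would be commutative, hence
-- not isomorphic to ℚ[θ₁,θ₂].
module Tensor (A B : Superalgebra) where

  private
    module A = Superalgebra A
    module B = Superalgebra B

  infix  4 _≈_
  infixl 6 _+_
  infixl 7 _*_
  infix  8 -_
  infix  9 _⊗ₑ_

  data Carrier : Set where
    0#   : Carrier
    _+_  : Carrier → Carrier → Carrier
    -_   : Carrier → Carrier
    _⊗ₑ_ : A.Carrier → B.Carrier → Carrier

  data _≈_ : Carrier → Carrier → Set where
    refl        : ∀ {x} → x ≈ x
    sym         : ∀ {x y} → x ≈ y → y ≈ x
    trans       : ∀ {x y z} → x ≈ y → y ≈ z → x ≈ z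
    +-cong      : ∀ {x x′ y y′} → x ≈ x′ → y ≈ y′ → x + y ≈ x′ + y′
    -‿cong      : ∀ {x x′} → x ≈ x′ → - x ≈ - x′
    +-assoc     : ∀ x y z → (x + y) + z ≈ x + (y + z)
    +-comm      : ∀ x y → x + y ≈ y + x
    +-identityˡ : ∀ x → 0# + x ≈ x
    -‿inverseˡ  : ∀ x → - x + x ≈ 0#
    ⊗-cong      : ∀ {a a′ b b′} → a A.≈ a′ → b B.≈ b′ → a ⊗ₑ b ≈ a′ ⊗ₑ b′
    ⊗-distribʳ  : ∀ a a′ b → (a A.+ a′) ⊗ₑ b ≈ a ⊗ₑ b + a′ ⊗ₑ b
    ⊗-distribˡ  : ∀ a b b′ → a ⊗ₑ (b B.+ b′) ≈ a ⊗ₑ b + a ⊗ₑ b′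
    ⊗-balanced  : ∀ q a b → (A.ι q A.* a) ⊗ₑ b ≈ a ⊗ₑ (B.ι q B.* b)

  +-isAbelianGroup : IsAbelianGroup _≈_ _+_ 0# -_
  +-isAbelianGroup = record
    { isGroup = record
      { isMonoid = record
        { isSemigroup = record
          { isMagma = record
            { isEquivalence = record { refl = refl ; sym = sym ; trans = trans }
            ; ∙-cong = +-cong }
          ; assoc = +-assoc }
        ; identity = +-identityˡ , λ x → trans (+-comm x 0#) (+-identityˡ x) }
      ; inverse = -‿inverseˡ , λ x → trans (+-comm x (- x)) (-‿inverseˡ x)
      ; ⁻¹-cong = -‿cong }
    ; comm = +-comm }

  private
    abelianGroup : AbelianGroup 0ℓ 0ℓ
    abelianGroup = record { isAbelianGroup = +-isAbelianGroup }
    open AbelianGroup abelianGroup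
      using (setoid; commutativeSemigroup)
      renaming (identityʳ to +-identityʳ; inverseʳ to -‿inverseʳ)
    open import Algebra.Properties.AbelianGroup abelianGroup
      using () renaming (∙-cancelˡ to +-cancelˡ; ⁻¹-∙-comm to -‿+-comm; ε⁻¹≈ε to -0≈0)
    open CommSemigroup commutativeSemigroup using (interchange)
    open SetoidReasoning setoid

  ⊗-zeroˡ : ∀ b → A.0# ⊗ₑ b ≈ 0#
  ⊗-zeroˡ b = +-cancelˡ (A.0# ⊗ₑ b) _ _ (begin
    A.0# ⊗ₑ b + A.0# ⊗ₑ b  ≈⟨ ⊗-distribʳ _ _ _ ⟨
    (A.0# A.+ A.0#) ⊗ₑ b   ≈⟨ ⊗-cong (A.+-identityʳ _) B.refl ⟩
    A.0# ⊗ₑ b              ≈⟨ +-identityʳ _ ⟨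
    A.0# ⊗ₑ b + 0#         ∎)

  ⊗-negˡ : ∀ a b → (A.- a) ⊗ₑ b ≈ - (a ⊗ₑ b)
  ⊗-negˡ a b = +-cancelˡ (a ⊗ₑ b) _ _ (begin
    a ⊗ₑ b + (A.- a) ⊗ₑ b  ≈⟨ ⊗-distribʳ _ _ _ ⟨
    (a A.+ A.- a) ⊗ₑ b     ≈⟨ ⊗-cong (A.-‿inverseʳ a) B.refl ⟩
    A.0# ⊗ₑ b              ≈⟨ ⊗-zeroˡ b ⟩
    0#                     ≈⟨ -‿inverseʳ _ ⟨
    a ⊗ₑ b + - (a ⊗ₑ b)    ∎)

  -- Left multiplication by the pure tensor a ⊗ b. For homogeneous b and c,
  -- (a ⊗ b)(c ⊗ d) = (-1)^(|b||c|) ac ⊗ bd.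
  pure* : A.Carrier → B.Carrier → Carrier → Carrier
  pure* a b 0#       = 0#
  pure* a b (x + y)  = pure* a b x + pure* a b y
  pure* a b (- x)    = - pure* a b x
  pure* a b (c ⊗ₑ d) = (a A.* A.part 0ℙ c) ⊗ₑ (B.sign 0ℙ b B.* d)
                     + (a A.* A.part 1ℙ c) ⊗ₑ (B.sign 1ℙ b B.* d)

  _*_ : Carrier → Carrier → Carrier
  0#       * y = 0#
  (x + x′) * y = x * y + x′ * y
  (- x)    * y = - (x * y)
  (a ⊗ₑ b) * y = pure* a b y

  1# : Carrier
  1# = A.1# ⊗ₑ B.1#

  ι : ℚ → Carrier
  ι q = A.ι q ⊗ₑ B.1#

  private
    -- One of the two homogeneous contributions to a product of pure tensors.
    term : Parity → A.Carrier → B.Carrier → A.Carrier → B.Carrier → Carrier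
    term p a b c d = (a A.* A.part p c) ⊗ₑ (B.sign p b B.* d)

    both : ∀ (x y : Parity → Carrier) → (∀ p → x p ≈ y p) →
           x 0ℙ + x 1ℙ ≈ y 0ℙ + y 1ℙ
    both x y f = +-cong (f 0ℙ) (f 1ℙ)

    both-+ : ∀ (x y z : Parity → Carrier) → (∀ p → x p ≈ y p + z p) →
           x 0ℙ + x 1ℙ ≈ (y 0ℙ + y 1ℙ) + (z 0ℙ + z 1ℙ)
    both-+ x y z f = trans (+-cong (f 0ℙ) (f 1ℙ)) (interchange _ _ _ _)

    neg-+ : ∀ {x y z} → x ≈ y + z → - x ≈ - y + - z
    neg-+ e = trans (-‿cong e) (sym (-‿+-comm _ _))

    ι-shift : ∀ q a b → a A.* (A.ι q A.* b) A.≈ A.ι q A.* (a A.* b)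
    ι-shift q a b = A.trans (A.sym (A.*-assoc _ _ _))
      (A.trans (A.*-congʳ (A.sym (A.ι-central q a))) (A.*-assoc _ _ _))

    ι-shiftB : ∀ q a b → a B.* (B.ι q B.* b) B.≈ B.ι q B.* (a B.* b)
    ι-shiftB q a b = B.trans (B.sym (B.*-assoc _ _ _))
      (B.trans (B.*-congʳ (B.sym (B.ι-central q a))) (B.*-assoc _ _ _))

    part-ι* : ∀ p q c → A.part p (A.ι q A.* c) A.≈ A.ι q A.* A.part p c
    part-ι* p q c = A.trans (A.part-* p _ c) (A.trans
      (A.+-cong (A.*-congʳ (A.part-ι q))
        (A.trans (A.*-congʳ (A.part-ι-odd q)) (A.zeroˡ _)))
      (A.+-identityʳ _))

  pure*-congʳ : ∀ {a a′ b b′} → a A.≈ a′ → b B.≈ b′ → ∀ y → pure* a b y ≈ pure* a′ b′ y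
  pure*-congʳ e f 0#       = refl
  pure*-congʳ e f (y + y′) = +-cong (pure*-congʳ e f y) (pure*-congʳ e f y′)
  pure*-congʳ e f (- y)    = -‿cong (pure*-congʳ e f y)
  pure*-congʳ {a} {a′} {b} {b′} e f (c ⊗ₑ d) =
    both (λ p → term p a b c d) (λ p → term p a′ b′ c d) λ p → ⊗-cong (A.*-congʳ e) (B.*-congʳ (B.sign-cong p f))

  pure*-distribʳ : ∀ a a′ b y → pure* (a A.+ a′) b y ≈ pure* a b y + pure* a′ b y
  pure*-distribʳ a a′ b 0#       = sym (+-identityˡ 0#)
  pure*-distribʳ a a′ b (y + y′) =
    trans (+-cong (pure*-distribʳ a a′ b y) (pure*-distribʳ a a′ b y′))
          (interchange _ _ _ _)
  pure*-distribʳ a a′ b (- y)    = neg-+ (pure*-distribʳ a a′ b y)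
  pure*-distribʳ a a′ b (c ⊗ₑ d) =
    both-+ _ (λ p → term p a b c d) (λ p → term p a′ b c d) λ p →
      trans (⊗-cong (A.distribʳ _ _ _) B.refl) (⊗-distribʳ _ _ _)

  pure*-distribˡ : ∀ a b b′ y → pure* a (b B.+ b′) y ≈ pure* a b y + pure* a b′ y
  pure*-distribˡ a b b′ 0#       = sym (+-identityˡ 0#)
  pure*-distribˡ a b b′ (y + y′) =
    trans (+-cong (pure*-distribˡ a b b′ y) (pure*-distribˡ a b b′ y′))
          (interchange _ _ _ _)
  pure*-distribˡ a b b′ (- y)    = neg-+ (pure*-distribˡ a b b′ y)
  pure*-distribˡ a b b′ (c ⊗ₑ d) =
    both-+ (λ p → term p a (b B.+ b′) c d) (λ p → term p a b c d) (λ p → term p a b′ c d) λ p →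
      trans (⊗-cong A.refl (B.trans (B.*-congʳ (B.sign-+ p b b′)) (B.distribʳ _ _ _)))
            (⊗-distribˡ _ _ _)

  pure*-balanced : ∀ q a b y → pure* (A.ι q A.* a) b y ≈ pure* a (B.ι q B.* b) y
  pure*-balanced q a b 0#       = refl
  pure*-balanced q a b (y + y′) = +-cong (pure*-balanced q a b y) (pure*-balanced q a b y′)
  pure*-balanced q a b (- y)    = -‿cong (pure*-balanced q a b y)
  pure*-balanced q a b (c ⊗ₑ d) =
    both (λ p → term p (A.ι q A.* a) b c d) (λ p → term p a (B.ι q B.* b) c d) λ p → begin
    (A.ι q A.* a A.* A.part p c) ⊗ₑ (B.sign p b B.* d)
      ≈⟨ ⊗-cong (A.*-assoc _ _ _) B.refl ⟩
    (A.ι q A.* (a A.* A.part p c)) ⊗ₑ (B.sign p b B.* d)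
      ≈⟨ ⊗-balanced _ _ _ ⟩
    (a A.* A.part p c) ⊗ₑ (B.ι q B.* (B.sign p b B.* d))
      ≈⟨ ⊗-cong A.refl (B.*-assoc _ _ _) ⟨
    (a A.* A.part p c) ⊗ₑ (B.ι q B.* B.sign p b B.* d)
      ≈⟨ ⊗-cong A.refl (B.*-congʳ (B.*-congʳ (B.sign-ι p q))) ⟨
    (a A.* A.part p c) ⊗ₑ (B.sign p (B.ι q) B.* B.sign p b B.* d)
      ≈⟨ ⊗-cong A.refl (B.*-congʳ (B.sign-* p (B.ι q) b)) ⟨
    (a A.* A.part p c) ⊗ₑ (B.sign p (B.ι q B.* b) B.* d) ∎

  pure*-congˡ : ∀ a b {y y′} → y ≈ y′ → pure* a b y ≈ pure* a b y′
  pure*-congˡ a b refl                = refl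
  pure*-congˡ a b (sym e)             = sym (pure*-congˡ a b e)
  pure*-congˡ a b (trans e f)         = trans (pure*-congˡ a b e) (pure*-congˡ a b f)
  pure*-congˡ a b (+-cong e f)        = +-cong (pure*-congˡ a b e) (pure*-congˡ a b f)
  pure*-congˡ a b (-‿cong e)          = -‿cong (pure*-congˡ a b e)
  pure*-congˡ a b (+-assoc x y z)     = +-assoc _ _ _
  pure*-congˡ a b (+-comm x y)        = +-comm _ _
  pure*-congˡ a b (+-identityˡ x)     = +-identityˡ _
  pure*-congˡ a b (-‿inverseˡ x)      = -‿inverseˡ _
  pure*-congˡ a b (⊗-cong {c} {c′} {d} {d′} e f) =
    both (λ p → term p a b c d) (λ p → term p a b c′ d′) λ p → ⊗-cong (A.*-congˡ (A.part-cong p e)) (B.*-congˡ f)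
  pure*-congˡ a b (⊗-distribʳ c c′ d) =
    both-+ (λ p → term p a b (c A.+ c′) d) (λ p → term p a b c d) (λ p → term p a b c′ d) λ p →
      trans (⊗-cong (A.trans (A.*-congˡ (A.part-+ p c c′)) (A.distribˡ _ _ _)) B.refl)
            (⊗-distribʳ _ _ _)
  pure*-congˡ a b (⊗-distribˡ c d d′) =
    both-+ (λ p → term p a b c (d B.+ d′)) (λ p → term p a b c d) (λ p → term p a b c d′) λ p →
      trans (⊗-cong A.refl (B.distribˡ _ _ _)) (⊗-distribˡ _ _ _)
  pure*-congˡ a b (⊗-balanced q c d)  =
    both (λ p → term p a b (A.ι q A.* c) d) (λ p → term p a b c (B.ι q B.* d)) λ p →
    trans (⊗-cong (A.trans (A.*-congˡ (part-ι* p q c)) (ι-shift q a _)) B.refl)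
      (trans (⊗-balanced _ _ _) (⊗-cong A.refl (B.sym (ι-shiftB q _ d))))

  *-congʳ : ∀ {x x′} → x ≈ x′ → ∀ y → x * y ≈ x′ * y
  *-congʳ refl                y = refl
  *-congʳ (sym e)             y = sym (*-congʳ e y)
  *-congʳ (trans e f)         y = trans (*-congʳ e y) (*-congʳ f y)
  *-congʳ (+-cong e f)        y = +-cong (*-congʳ e y) (*-congʳ f y)
  *-congʳ (-‿cong e)          y = -‿cong (*-congʳ e y)
  *-congʳ (+-assoc _ _ _)     y = +-assoc _ _ _
  *-congʳ (+-comm _ _)        y = +-comm _ _
  *-congʳ (+-identityˡ _)     y = +-identityˡ _
  *-congʳ (-‿inverseˡ _)      y = -‿inverseˡ _
  *-congʳ (⊗-cong e f)        y = pure*-congʳ e f y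
  *-congʳ (⊗-distribʳ a a′ b) y = pure*-distribʳ a a′ b y
  *-congʳ (⊗-distribˡ a b b′) y = pure*-distribˡ a b b′ y
  *-congʳ (⊗-balanced q a b)  y = pure*-balanced q a b y

  *-congˡ : ∀ x {y y′} → y ≈ y′ → x * y ≈ x * y′
  *-congˡ 0#       e = refl
  *-congˡ (x + x′) e = +-cong (*-congˡ x e) (*-congˡ x′ e)
  *-congˡ (- x)    e = -‿cong (*-congˡ x e)
  *-congˡ (a ⊗ₑ b) e = pure*-congˡ a b e

  *-distribˡ : ∀ x y z → x * (y + z) ≈ x * y + x * z
  *-distribˡ 0#       y z = sym (+-identityˡ 0#)
  *-distribˡ (x + x′) y z =
    trans (+-cong (*-distribˡ x y z) (*-distribˡ x′ y z)) (interchange _ _ _ _)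
  *-distribˡ (- x)    y z = neg-+ (*-distribˡ x y z)
  *-distribˡ (a ⊗ₑ b) y z = refl

  private
    *-neg : ∀ x y → x * (- y) ≈ - (x * y)
    *-neg 0#       y = sym -0≈0
    *-neg (x + x′) y = trans (+-cong (*-neg x y) (*-neg x′ y)) (-‿+-comm _ _)
    *-neg (- x)    y = -‿cong (*-neg x y)
    *-neg (a ⊗ₑ b) y = refl

    *-zero : ∀ x → x * 0# ≈ 0#
    *-zero 0#       = refl
    *-zero (x + x′) = trans (+-cong (*-zero x) (*-zero x′)) (+-identityˡ 0#)
    *-zero (- x)    = trans (-‿cong (*-zero x)) -0≈0
    *-zero (a ⊗ₑ b) = refl

    part-part* : ∀ p r c e →
      A.part p (c A.* A.part r e) A.≈ A.part (p ℙ.+ r) c A.* A.part r e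
    part-part* 0ℙ 0ℙ c e = A.trans (A.part-* 0ℙ c _) (A.trans
      (A.+-cong (A.*-congˡ (A.part-idem 0ℙ e))
                (A.trans (A.*-congˡ (A.part-disjoint 0ℙ e)) (A.zeroʳ _)))
      (A.+-identityʳ _))
    part-part* 0ℙ 1ℙ c e = A.trans (A.part-* 0ℙ c _) (A.trans
      (A.+-cong (A.trans (A.*-congˡ (A.part-disjoint 1ℙ e)) (A.zeroʳ _))
                (A.*-congˡ (A.part-idem 1ℙ e)))
      (A.+-identityˡ _))
    part-part* 1ℙ 0ℙ c e = A.trans (A.part-* 1ℙ c _) (A.trans
      (A.+-cong (A.trans (A.*-congˡ (A.part-disjoint 0ℙ e)) (A.zeroʳ _))
                (A.*-congˡ (A.part-idem 0ℙ e)))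
      (A.+-identityˡ _))
    part-part* 1ℙ 1ℙ c e = A.trans (A.part-* 1ℙ c _) (A.trans
      (A.+-cong (A.*-congˡ (A.part-idem 1ℙ e))
                (A.trans (A.*-congˡ (A.part-disjoint 1ℙ e)) (A.zeroʳ _)))
      (A.+-identityʳ _))

    sign-comp : ∀ p r b → B.sign r (B.sign p b) B.≈ B.sign (p ℙ.+ r) b
    sign-comp 0ℙ r  b = B.refl
    sign-comp 1ℙ 0ℙ b = B.refl
    sign-comp 1ℙ 1ℙ b = B.sign-sign b

    term-assoc : ∀ p r a b c d e f →
      term r (a A.* A.part p c) (B.sign p b B.* d) e f ≈
      term (p ℙ.+ r) a b (c A.* A.part r e) (B.sign r d B.* f)
    term-assoc p r a b c d e f = ⊗-cong
      (A.trans (A.*-assoc _ _ _) (A.*-congˡ (A.sym (lemma p r))))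
      (B.trans (B.*-congʳ (B.trans (B.sign-* r _ d) (B.*-congʳ (sign-comp p r b))))
               (B.*-assoc _ _ _))
      where
      lemma : ∀ p r → A.part (p ℙ.+ r) (c A.* A.part r e) A.≈ A.part p c A.* A.part r e
      lemma 0ℙ 0ℙ = part-part* 0ℙ 0ℙ c e
      lemma 0ℙ 1ℙ = part-part* 1ℙ 1ℙ c e
      lemma 1ℙ 0ℙ = part-part* 1ℙ 0ℙ c e
      lemma 1ℙ 1ℙ = part-part* 0ℙ 1ℙ c e

    pure-assoc : ∀ a b c d z → (pure* a b (c ⊗ₑ d)) * z ≈ pure* a b (pure* c d z)
    pure-assoc a b c d 0#       = +-identityˡ 0#
    pure-assoc a b c d (z + z′) =
      trans (*-distribˡ (pure* a b (c ⊗ₑ d)) z z′)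
            (+-cong (pure-assoc a b c d z) (pure-assoc a b c d z′))
    pure-assoc a b c d (- z)    =
      trans (*-neg (pure* a b (c ⊗ₑ d)) z) (-‿cong (pure-assoc a b c d z))
    pure-assoc a b c d (e ⊗ₑ f) = begin
      (s 0ℙ 0ℙ + s 0ℙ 1ℙ) + (s 1ℙ 0ℙ + s 1ℙ 1ℙ)
        ≈⟨ +-congˡ′ (+-comm _ _) ⟩
      (s 0ℙ 0ℙ + s 0ℙ 1ℙ) + (s 1ℙ 1ℙ + s 1ℙ 0ℙ)
        ≈⟨ +-cong (+-cong (t 0ℙ 0ℙ) (t 0ℙ 1ℙ)) (+-cong (t 1ℙ 1ℙ) (t 1ℙ 0ℙ)) ⟩
      (u 0ℙ 0ℙ + u 1ℙ 1ℙ) + (u 0ℙ 1ℙ + u 1ℙ 0ℙ)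
        ≈⟨ +-congˡ′ (+-comm _ _) ⟩
      (u 0ℙ 0ℙ + u 1ℙ 1ℙ) + (u 1ℙ 0ℙ + u 0ℙ 1ℙ)
        ≈⟨ interchange _ _ _ _ ⟩
      (u 0ℙ 0ℙ + u 1ℙ 0ℙ) + (u 1ℙ 1ℙ + u 0ℙ 1ℙ)
        ≈⟨ +-congˡ′ (+-comm _ _) ⟩
      (u 0ℙ 0ℙ + u 1ℙ 0ℙ) + (u 0ℙ 1ℙ + u 1ℙ 1ℙ) ∎
      where
      +-congˡ′ : ∀ {x y y′} → y ≈ y′ → x + y ≈ x + y′
      +-congˡ′ = +-cong refl
      s u : Parity → Parity → Carrier
      s p r = term r (a A.* A.part p c) (B.sign p b B.* d) e f
      u p r = term p a b (c A.* A.part r e) (B.sign r d B.* f)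
      t : ∀ p r → s p r ≈ u (p ℙ.+ r) r
      t p r = term-assoc p r a b c d e f

    pure*-assoc : ∀ a b y z → (pure* a b y) * z ≈ pure* a b (y * z)
    pure*-assoc a b 0#       z = refl
    pure*-assoc a b (y + y′) z = +-cong (pure*-assoc a b y z) (pure*-assoc a b y′ z)
    pure*-assoc a b (- y)    z = -‿cong (pure*-assoc a b y z)
    pure*-assoc a b (c ⊗ₑ d) z = pure-assoc a b c d z

  *-assoc : ∀ x y z → (x * y) * z ≈ x * (y * z)
  *-assoc 0#       y z = refl
  *-assoc (x + x′) y z = +-cong (*-assoc x y z) (*-assoc x′ y z)
  *-assoc (- x)    y z = -‿cong (*-assoc x y z)
  *-assoc (a ⊗ₑ b) y z = pure*-assoc a b y z

  private
    sign-1 : ∀ p → B.sign p B.1# B.≈ B.1#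
    sign-1 p = B.trans (B.sign-cong p (B.sym B.ι.1#-homo))
                       (B.trans (B.sign-ι p 1ℚ) B.ι.1#-homo)

    ι*-pure : ∀ q c d → ι q * (c ⊗ₑ d) ≈ (A.ι q A.* c) ⊗ₑ d
    ι*-pure q c d = begin
      ι q * (c ⊗ₑ d)
        ≈⟨ both (λ p → term p (A.ι q) B.1# c d) (λ p → (A.ι q A.* A.part p c) ⊗ₑ d)
             (λ p → ⊗-cong A.refl (B.trans (B.*-congʳ (sign-1 p)) (B.*-identityˡ d))) ⟩
      (A.ι q A.* A.part 0ℙ c) ⊗ₑ d + (A.ι q A.* A.part 1ℙ c) ⊗ₑ d
        ≈⟨ ⊗-distribʳ _ _ _ ⟨
      (A.ι q A.* A.part 0ℙ c A.+ A.ι q A.* A.part 1ℙ c) ⊗ₑ d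
        ≈⟨ ⊗-cong (A.trans (A.sym (A.distribˡ _ _ _)) (A.*-congˡ (A.part-sum c))) B.refl ⟩
      (A.ι q A.* c) ⊗ₑ d ∎

    pure-*ι : ∀ q c d → (c ⊗ₑ d) * ι q ≈ (A.ι q A.* c) ⊗ₑ d
    pure-*ι q c d = begin
      (c ⊗ₑ d) * ι q
        ≈⟨ +-cong (⊗-cong (A.*-congˡ (A.part-ι q)) (B.*-identityʳ d))
                  (trans (⊗-cong (A.trans (A.*-congˡ (A.part-ι-odd q)) (A.zeroʳ c)) B.refl)
                         (⊗-zeroˡ _)) ⟩
      (c A.* A.ι q) ⊗ₑ d + 0#
        ≈⟨ +-identityʳ _ ⟩
      (c A.* A.ι q) ⊗ₑ d
        ≈⟨ ⊗-cong (A.ι-central q c) B.refl ⟨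
      (A.ι q A.* c) ⊗ₑ d ∎

    ι1≈1 : ι 1ℚ ≈ 1#
    ι1≈1 = ⊗-cong A.ι.1#-homo B.refl

    unit : ∀ c → A.ι 1ℚ A.* c A.≈ c
    unit c = A.trans (A.*-congʳ A.ι.1#-homo) (A.*-identityˡ c)

    ι1-identityˡ : ∀ x → ι 1ℚ * x ≈ x
    ι1-identityˡ 0#       = refl
    ι1-identityˡ (x + y)  = +-cong (ι1-identityˡ x) (ι1-identityˡ y)
    ι1-identityˡ (- x)    = -‿cong (ι1-identityˡ x)
    ι1-identityˡ (c ⊗ₑ d) = trans (ι*-pure 1ℚ c d) (⊗-cong (unit c) B.refl)

    ι1-identityʳ : ∀ x → x * ι 1ℚ ≈ x
    ι1-identityʳ 0#       = refl
    ι1-identityʳ (x + y)  = +-cong (ι1-identityʳ x) (ι1-identityʳ y)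
    ι1-identityʳ (- x)    = -‿cong (ι1-identityʳ x)
    ι1-identityʳ (c ⊗ₑ d) = trans (pure-*ι 1ℚ c d) (⊗-cong (unit c) B.refl)

  ι-central : ∀ q x → ι q * x ≈ x * ι q
  ι-central q 0#       = refl
  ι-central q (x + y)  = +-cong (ι-central q x) (ι-central q y)
  ι-central q (- x)    = -‿cong (ι-central q x)
  ι-central q (c ⊗ₑ d) = trans (ι*-pure q c d) (sym (pure-*ι q c d))

  ring : Ring 0ℓ 0ℓ
  ring = record
    { Carrier = Carrier ; _≈_ = _≈_ ; _+_ = _+_ ; _*_ = _*_
    ; -_ = -_ ; 0# = 0# ; 1# = 1#
    ; isRing = record
      { +-isAbelianGroup = +-isAbelianGroup
      ; *-cong = λ {x} {x′} {y} {y′} e f → trans (*-congʳ e y) (*-congˡ x′ f)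
      ; *-assoc = *-assoc
      ; *-identity = (λ x → trans (*-congʳ (sym ι1≈1) x) (ι1-identityˡ x))
                   , (λ x → trans (*-congˡ x (sym ι1≈1)) (ι1-identityʳ x))
      ; distrib = *-distribˡ , λ x y z → refl
      }
    }

  ι-isRingHomomorphism : IsRingHomomorphism ℚ.+-*-rawRing (Ring.rawRing ring) ι
  ι-isRingHomomorphism = record
    { isSemiringHomomorphism = record
      { isNearSemiringHomomorphism = record
        { +-isMonoidHomomorphism = record
          { isMagmaHomomorphism = record
            { isRelHomomorphism = record { cong = λ { ≡.refl → refl } }
            ; homo = λ p q → trans (⊗-cong (A.ι.+-homo p q) B.refl) (⊗-distribʳ _ _ _) }
          ; ε-homo = trans (⊗-cong A.ι.0#-homo B.refl) (⊗-zeroˡ _) }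
        ; *-homo = λ p q → trans (⊗-cong (A.ι.*-homo p q) B.refl) (sym (ι*-pure p _ _)) }
      ; 1#-homo = ι1≈1 }
    ; -‿homo = λ q → trans (⊗-cong (A.ι.-‿homo q) B.refl) (⊗-negˡ _ _) }

infixl 7 _⊗_

_⊗_ : Superalgebra → Superalgebra → Algebra
A ⊗ B = record
  { ring = ring
  ; ι = ι
  ; ι-isRingHomomorphism = ι-isRingHomomorphism
  ; ι-central = ι-central
  }
  where open Tensor A B

module Ideal (A : Superalgebra) (P : Superalgebra.Carrier A → Set) where

  open Superalgebra A hiding (zero)

  data ⟨_⟩ : Carrier → Set where
    gen  : ∀ {x} → P x → ⟨_⟩ x
    zero : ⟨_⟩ 0#
    add  : ∀ {x y} → ⟨_⟩ x → ⟨_⟩ y → ⟨_⟩ (x + y)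
    mulˡ : ∀ x {y} → ⟨_⟩ y → ⟨_⟩ (x * y)
    mulʳ : ∀ {x} y → ⟨_⟩ x → ⟨_⟩ (x * y)
    resp : ∀ {x y} → x ≈ y → ⟨_⟩ x → ⟨_⟩ y

  neg : ∀ {x} → ⟨_⟩ x → ⟨_⟩ (- x)
  neg {x} i = resp (-1*x≈-x x) (mulˡ (- 1#) i)

  infix 4 _∼_

  record _∼_ (x y : Carrier) : Set where
    constructor mk
    field un : ⟨_⟩ (x - y)
  open _∼_ public

  private
    -‿swap : ∀ x y → - (x - y) ≈ y - x
    -‿swap x y = trans (sym (-‿+-comm x (- y)))
                       (trans (+-congˡ (-‿involutive y)) (+-comm _ _))

    telescope : ∀ x y z → (x - y) + (y - z) ≈ x - z
    telescope x y z = trans (+-assoc _ _ _) (+-congˡ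
      (trans (sym (+-assoc _ _ _)) (trans (+-congʳ (-‿inverseˡ y)) (+-identityˡ _))))

    +-swap : ∀ x x′ y y′ → (x - x′) + (y - y′) ≈ (x + y) - (x′ + y′)
    +-swap x x′ y y′ = trans (interchange _ _ _ _) (+-congˡ (-‿+-comm x′ y′))

    *-diff : ∀ x x′ y y′ → (x - x′) * y + x′ * (y - y′) ≈ x * y - x′ * y′
    *-diff x x′ y y′ = trans
      (+-cong (trans (distribʳ _ _ _) (+-congˡ (sym (-‿distribˡ-* _ _))))
              (trans (distribˡ _ _ _) (+-congˡ (sym (-‿distribʳ-* _ _)))))
      (telescope _ _ _)

  ≈⇒∼ : ∀ {x y} → x ≈ y → x ∼ y
  ≈⇒∼ {x} {y} e = mk (resp (sym (trans (+-congʳ e) (-‿inverseʳ y))) zero)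

  ∼-sym : ∀ {x y} → x ∼ y → y ∼ x
  ∼-sym {x} {y} (mk i) = mk (resp (-‿swap x y) (neg i))

  ∼-trans : ∀ {x y z} → x ∼ y → y ∼ z → x ∼ z
  ∼-trans {x} {y} {z} (mk i) (mk j) = mk (resp (telescope x y z) (add i j))

  quotientRing : Ring 0ℓ 0ℓ
  quotientRing = record
    { Carrier = Carrier ; _≈_ = _∼_ ; _+_ = _+_ ; _*_ = _*_
    ; -_ = -_ ; 0# = 0# ; 1# = 1#
    ; isRing = record
      { +-isAbelianGroup = record
        { isGroup = record
          { isMonoid = record
            { isSemigroup = record
              { isMagma = record
                { isEquivalence = record
                  { refl = ≈⇒∼ refl ; sym = ∼-sym ; trans = ∼-trans }
                ; ∙-cong = λ { (mk i) (mk j) → mk (resp (+-swap _ _ _ _) (add i j)) } }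
              ; assoc = λ x y z → ≈⇒∼ (+-assoc x y z) }
            ; identity = (λ x → ≈⇒∼ (+-identityˡ x)) , (λ x → ≈⇒∼ (+-identityʳ x)) }
          ; inverse = (λ x → ≈⇒∼ (-‿inverseˡ x)) , (λ x → ≈⇒∼ (-‿inverseʳ x))
          ; ⁻¹-cong = λ { {x} {y} (mk i) → mk (resp (sym (-‿+-comm x (- y))) (neg i)) } }
        ; comm = λ x y → ≈⇒∼ (+-comm x y) }
      ; *-cong = λ { {x} {x′} {y} {y′} (mk i) (mk j) →
          mk (resp (*-diff x x′ y y′) (add (mulʳ y i) (mulˡ x′ j))) }
      ; *-assoc = λ x y z → ≈⇒∼ (*-assoc x y z)
      ; *-identity = (λ x → ≈⇒∼ (*-identityˡ x)) , (λ x → ≈⇒∼ (*-identityʳ x))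
      ; distrib = (λ x y z → ≈⇒∼ (distribˡ x y z)) , (λ x y z → ≈⇒∼ (distribʳ x y z))
      }
    }

  quotientAlgebra : Algebra
  quotientAlgebra = record
    { ring = quotientRing
    ; ι = ι
    ; ι-isRingHomomorphism = record
      { isSemiringHomomorphism = record
        { isNearSemiringHomomorphism = record
          { +-isMonoidHomomorphism = record
            { isMagmaHomomorphism = record
              { isRelHomomorphism = record { cong = λ e → ≈⇒∼ (ι.⟦⟧-cong e) }
              ; homo = λ p q → ≈⇒∼ (ι.+-homo p q) }
            ; ε-homo = ≈⇒∼ ι.0#-homo }
          ; *-homo = λ p q → ≈⇒∼ (ι.*-homo p q) }
        ; 1#-homo = ≈⇒∼ ι.1#-homo }
      ; -‿homo = λ q → ≈⇒∼ (ι.-‿homo q) }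
    ; ι-central = λ q x → ≈⇒∼ (ι-central q x)
    }

  -- The grading descends to the quotient when the generators have their
  -- homogeneous parts in the ideal.
  module _ (homogeneous : ∀ p {x} → P x → ⟨_⟩ (part p x)) where

    ⟨⟩-part : ∀ p {x} → ⟨_⟩ x → ⟨_⟩ (part p x)
    ⟨⟩-part p (gen g)          = homogeneous p g
    ⟨⟩-part p zero             = resp (sym (part-0 p)) zero
    ⟨⟩-part p (add i j)        = resp (sym (part-+ p _ _)) (add (⟨⟩-part p i) (⟨⟩-part p j))
    ⟨⟩-part p (mulˡ x i)       = resp (sym (part-* p _ _))
      (add (mulˡ _ (⟨⟩-part p i)) (mulˡ _ (⟨⟩-part (p ℙ.⁻¹) i)))
    ⟨⟩-part p (mulʳ y i)       = resp (sym (part-* p _ _))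
      (add (mulʳ _ (⟨⟩-part 0ℙ i)) (mulʳ _ (⟨⟩-part 1ℙ i)))
    ⟨⟩-part p (resp e i)       = resp (part-cong p e) (⟨⟩-part p i)

    quotient : Superalgebra
    quotient = record
      { algebra = quotientAlgebra
      ; part = part
      ; part-cong = λ { p {x} {y} (mk i) → mk (resp
          (trans (part-+ p x (- y)) (+-congˡ (part-‿ p y))) (⟨⟩-part p i)) }
      ; part-+ = λ p x y → ≈⇒∼ (part-+ p x y)
      ; part-* = λ p x y → ≈⇒∼ (part-* p x y)
      ; part-ι = λ q → ≈⇒∼ (part-ι q)
      ; part-sum = λ x → ≈⇒∼ (part-sum x)
      ; part-disjoint = λ p x → ≈⇒∼ (part-disjoint p x)
      }

module _ {S : Ring 0ℓ 0ℓ} (M : LeftModule S 0ℓ 0ℓ) where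

  private module S = Ring S
  open LeftModule M
  open Sum (Monoid.rawMonoid +ᴹ-monoid) using (sum)

  record IsBasis {I : Set} (b : I → Carrierᴹ) : Set where
    field
      spanning    : ∀ m → ∃ λ k → ∃ λ (f : Fin k → I) → ∃ λ (c : Fin k → S.Carrier) →
                    m ≈ᴹ sum (λ i → c i *ₗ b (f i))
      independent : ∀ k (f : Fin k → I) → Injective _≡_ _≡_ f →
                    ∀ (c : Fin k → S.Carrier) →
                    sum (λ i → c i *ₗ b (f i)) ≈ᴹ 0ᴹ → ∀ i → c i S.≈ S.0#

  IsFree : Set₁
  IsFree = ∃ λ (I : Set) → ∃ λ (b : I → Carrierᴹ) → IsBasis b

module _ (n : ℕ) where

  infix  4 _≈ᴿ_
  infixl 6 _+ᴿ_
  infixl 7 _*ᴿ_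
  infix  8 -ᴿ_

  -- ℚ[θ₁,…,θₙ] with anticommuting variables, presented by generators and
  -- relations: polynomial expressions up to the congruence _≈ᴿ_.
  data Poly : Set where
    con  : ℚ → Poly
    θ    : Fin n → Poly
    _+ᴿ_ : Poly → Poly → Poly
    _*ᴿ_ : Poly → Poly → Poly
    -ᴿ_  : Poly → Poly

  data _≈ᴿ_ : Poly → Poly → Set where
    refl        : ∀ {x} → x ≈ᴿ x
    sym         : ∀ {x y} → x ≈ᴿ y → y ≈ᴿ x
    trans       : ∀ {x y z} → x ≈ᴿ y → y ≈ᴿ z → x ≈ᴿ z
    +-cong      : ∀ {x x′ y y′} → x ≈ᴿ x′ → y ≈ᴿ y′ → x +ᴿ y ≈ᴿ x′ +ᴿ y′
    *-cong      : ∀ {x x′ y y′} → x ≈ᴿ x′ → y ≈ᴿ y′ → x *ᴿ y ≈ᴿ x′ *ᴿ y′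
    -‿cong      : ∀ {x x′} → x ≈ᴿ x′ → -ᴿ x ≈ᴿ -ᴿ x′
    +-assoc     : ∀ x y z → (x +ᴿ y) +ᴿ z ≈ᴿ x +ᴿ (y +ᴿ z)
    +-comm      : ∀ x y → x +ᴿ y ≈ᴿ y +ᴿ x
    +-identityˡ : ∀ x → con 0ℚ +ᴿ x ≈ᴿ x
    -‿inverseˡ  : ∀ x → -ᴿ x +ᴿ x ≈ᴿ con 0ℚ
    *-assoc     : ∀ x y z → (x *ᴿ y) *ᴿ z ≈ᴿ x *ᴿ (y *ᴿ z)
    *-identityˡ : ∀ x → con 1ℚ *ᴿ x ≈ᴿ x
    distribˡ    : ∀ x y z → x *ᴿ (y +ᴿ z) ≈ᴿ x *ᴿ y +ᴿ x *ᴿ z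
    distribʳ    : ∀ x y z → (y +ᴿ z) *ᴿ x ≈ᴿ y *ᴿ x +ᴿ z *ᴿ x
    con-+       : ∀ p q → con (p ℚ.+ q) ≈ᴿ con p +ᴿ con q
    con-*       : ∀ p q → con (p ℚ.* q) ≈ᴿ con p *ᴿ con q
    con-central : ∀ q x → con q *ᴿ x ≈ᴿ x *ᴿ con q
    θ-anticomm  : ∀ {i j} → i ≢ j → θ i *ᴿ θ j ≈ᴿ -ᴿ (θ j *ᴿ θ i)
    θ-square    : ∀ i → θ i *ᴿ θ i ≈ᴿ con 0ℚ

module _ {n : ℕ} where

  -- The homogeneous component of degree d: the ℚ-span of the products of d variables.
  data Homogeneous : ℕ → Poly n → Set where
    con  : ∀ q → Homogeneous 0 (con q)
    θ    : ∀ i → Homogeneous 1 (θ i)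
    zero : ∀ {d} → Homogeneous d (con 0ℚ)
    add  : ∀ {d x y} → Homogeneous d x → Homogeneous d y → Homogeneous d (x +ᴿ y)
    mul  : ∀ {d e x y} → Homogeneous d x → Homogeneous e y → Homogeneous (d ℕ.+ e) (x *ᴿ y)
    neg  : ∀ {d x} → Homogeneous d x → Homogeneous d (-ᴿ x)
    resp : ∀ {d x y} → _≈ᴿ_ n x y → Homogeneous d x → Homogeneous d y

  act : Permutation′ n → Poly n → Poly n
  act σ (con q)  = con q
  act σ (θ i)    = θ (σ ⟨$⟩ʳ i)
  act σ (x +ᴿ y) = act σ x +ᴿ act σ y
  act σ (x *ᴿ y) = act σ x *ᴿ act σ y
  act σ (-ᴿ x)   = -ᴿ act σ x

  act-cong : ∀ σ {x y} → _≈ᴿ_ n x y → _≈ᴿ_ n (act σ x) (act σ y)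
  act-cong σ refl              = refl
  act-cong σ (sym e)           = sym (act-cong σ e)
  act-cong σ (trans e f)       = trans (act-cong σ e) (act-cong σ f)
  act-cong σ (+-cong e f)      = +-cong (act-cong σ e) (act-cong σ f)
  act-cong σ (*-cong e f)      = *-cong (act-cong σ e) (act-cong σ f)
  act-cong σ (-‿cong e)        = -‿cong (act-cong σ e)
  act-cong σ (+-assoc _ _ _)   = +-assoc _ _ _
  act-cong σ (+-comm _ _)      = +-comm _ _
  act-cong σ (+-identityˡ _)   = +-identityˡ _
  act-cong σ (-‿inverseˡ _)    = -‿inverseˡ _
  act-cong σ (*-assoc _ _ _)   = *-assoc _ _ _
  act-cong σ (*-identityˡ _)   = *-identityˡ _
  act-cong σ (distribˡ _ _ _)  = distribˡ _ _ _
  act-cong σ (distribʳ _ _ _)  = distribʳ _ _ _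
  act-cong σ (con-+ p q)       = con-+ p q
  act-cong σ (con-* p q)       = con-* p q
  act-cong σ (con-central q _) = con-central q _
  act-cong σ (θ-anticomm i≢j)  = θ-anticomm λ e → i≢j
    (≡.trans (≡.sym (inverseˡ σ)) (≡.trans (≡.cong (σ ⟨$⟩ˡ_) e) (inverseˡ σ)))
  act-cong σ (θ-square i)      = θ-square (σ ⟨$⟩ʳ i)

  Symmetric : Poly n → Set
  Symmetric x = ∀ σ → _≈ᴿ_ n (act σ x) x

  partᴿ : Parity → Poly n → Poly n
  partᴿ 0ℙ (con q)  = con q
  partᴿ 1ℙ (con q)  = con 0ℚ
  partᴿ 0ℙ (θ i)    = con 0ℚ
  partᴿ 1ℙ (θ i)    = θ i
  partᴿ p  (x +ᴿ y) = partᴿ p x +ᴿ partᴿ p y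
  partᴿ p  (x *ᴿ y) = partᴿ 0ℙ x *ᴿ partᴿ p y +ᴿ partᴿ 1ℙ x *ᴿ partᴿ (p ℙ.⁻¹) y
  partᴿ p  (-ᴿ x)   = -ᴿ partᴿ p x

module _ (n : ℕ) where

  private
    infix 4 _≈_
    _≈_ : Poly n → Poly n → Set
    _≈_ = _≈ᴿ_ n

    *-identityʳ : ∀ x → x *ᴿ con 1ℚ ≈ x
    *-identityʳ x = trans (sym (con-central 1ℚ x)) (*-identityˡ x)

  polyRing : Ring 0ℓ 0ℓ
  polyRing = record
    { Carrier = Poly n ; _≈_ = _≈ᴿ_ n ; _+_ = _+ᴿ_ ; _*_ = _*ᴿ_
    ; -_ = -ᴿ_ ; 0# = con 0ℚ ; 1# = con 1ℚ
    ; isRing = record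
      { +-isAbelianGroup = record
        { isGroup = record
          { isMonoid = record
            { isSemigroup = record
              { isMagma = record
                { isEquivalence = record { refl = refl ; sym = sym ; trans = trans }
                ; ∙-cong = +-cong }
              ; assoc = +-assoc }
            ; identity = +-identityˡ , λ x → trans (+-comm x _) (+-identityˡ x) }
          ; inverse = -‿inverseˡ , λ x → trans (+-comm x _) (-‿inverseˡ x)
          ; ⁻¹-cong = -‿cong }
        ; comm = +-comm }
      ; *-cong = *-cong
      ; *-assoc = *-assoc
      ; *-identity = *-identityˡ , *-identityʳ
      ; distrib = distribˡ , distribʳ
      }
    }

  private
    module PR where
      open Ring polyRing public
      open RingProperties polyRing public
      open CommSemigroup +-commutativeSemigroup public using (interchange)
    open SetoidReasoning PR.setoid

    con-neg : ∀ q → con (ℚ.- q) ≈ -ᴿ con q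
    con-neg q = PR.+-cancelˡ (con q) _ _ (begin
      con q +ᴿ con (ℚ.- q) ≈⟨ con-+ q (ℚ.- q) ⟨
      con (q ℚ.- q)        ≡⟨ ≡.cong con (ℚ.+-inverseʳ q) ⟩
      con 0ℚ               ≈⟨ PR.-‿inverseʳ _ ⟨
      con q +ᴿ -ᴿ con q    ∎)

  polyAlgebra : Algebra
  polyAlgebra = record
    { ring = polyRing
    ; ι = con
    ; ι-isRingHomomorphism = record
      { isSemiringHomomorphism = record
        { isNearSemiringHomomorphism = record
          { +-isMonoidHomomorphism = record
            { isMagmaHomomorphism = record
              { isRelHomomorphism = record { cong = λ { ≡.refl → refl } }
              ; homo = con-+ }
            ; ε-homo = refl }
          ; *-homo = con-* }
        ; 1#-homo = refl }
      ; -‿homo = con-neg }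
    ; ι-central = con-central
    }

  private
    0+0 : con 0ℚ +ᴿ con 0ℚ ≈ con 0ℚ
    0+0 = +-identityˡ _

    kill₂ : ∀ {x y z} → y ≈ con 0ℚ → x +ᴿ y *ᴿ z ≈ x
    kill₂ e = trans (+-cong refl (trans (*-cong e refl) (PR.zeroˡ _))) (PR.+-identityʳ _)

    kill₂ʳ : ∀ {x y z} → z ≈ con 0ℚ → x +ᴿ y *ᴿ z ≈ x
    kill₂ʳ e = trans (+-cong refl (trans (*-cong refl e) (PR.zeroʳ _))) (PR.+-identityʳ _)

    kill₁ : ∀ {x y z} → y ≈ con 0ℚ → y *ᴿ z +ᴿ x ≈ x
    kill₁ e = trans (+-comm _ _) (kill₂ e)

    kill₁ʳ : ∀ {x y z} → z ≈ con 0ℚ → y *ᴿ z +ᴿ x ≈ x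
    kill₁ʳ e = trans (+-comm _ _) (kill₂ʳ e)

    assoc-lemma : ∀ x₀ x₁ y₀ y₁ z z′ →
      (x₀ *ᴿ y₀ +ᴿ x₁ *ᴿ y₁) *ᴿ z +ᴿ (x₀ *ᴿ y₁ +ᴿ x₁ *ᴿ y₀) *ᴿ z′ ≈
      x₀ *ᴿ (y₀ *ᴿ z +ᴿ y₁ *ᴿ z′) +ᴿ x₁ *ᴿ (y₀ *ᴿ z′ +ᴿ y₁ *ᴿ z)
    assoc-lemma x₀ x₁ y₀ y₁ z z′ = begin
      (x₀ *ᴿ y₀ +ᴿ x₁ *ᴿ y₁) *ᴿ z +ᴿ (x₀ *ᴿ y₁ +ᴿ x₁ *ᴿ y₀) *ᴿ z′
        ≈⟨ +-cong (trans (distribʳ _ _ _) (+-cong (*-assoc _ _ _) (*-assoc _ _ _)))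
                  (trans (distribʳ _ _ _) (+-cong (*-assoc _ _ _) (*-assoc _ _ _))) ⟩
      (x₀ *ᴿ (y₀ *ᴿ z) +ᴿ x₁ *ᴿ (y₁ *ᴿ z)) +ᴿ (x₀ *ᴿ (y₁ *ᴿ z′) +ᴿ x₁ *ᴿ (y₀ *ᴿ z′))
        ≈⟨ PR.interchange _ _ _ _ ⟩
      (x₀ *ᴿ (y₀ *ᴿ z) +ᴿ x₀ *ᴿ (y₁ *ᴿ z′)) +ᴿ (x₁ *ᴿ (y₁ *ᴿ z) +ᴿ x₁ *ᴿ (y₀ *ᴿ z′))
        ≈⟨ +-cong (sym (distribˡ _ _ _)) (trans (+-comm _ _) (sym (distribˡ _ _ _))) ⟩
      x₀ *ᴿ (y₀ *ᴿ z +ᴿ y₁ *ᴿ z′) +ᴿ x₁ *ᴿ (y₀ *ᴿ z′ +ᴿ y₁ *ᴿ z) ∎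

  partᴿ-cong : ∀ p {x y} → x ≈ y → partᴿ p x ≈ partᴿ p y
  partᴿ-cong p refl = refl
  partᴿ-cong p (sym e) = sym (partᴿ-cong p e)
  partᴿ-cong p (trans e f) = trans (partᴿ-cong p e) (partᴿ-cong p f)
  partᴿ-cong 0ℙ (+-cong e f) = +-cong (partᴿ-cong 0ℙ e) (partᴿ-cong 0ℙ f)
  partᴿ-cong 1ℙ (+-cong e f) = +-cong (partᴿ-cong 1ℙ e) (partᴿ-cong 1ℙ f)
  partᴿ-cong 0ℙ (*-cong e f) =
    +-cong (*-cong (partᴿ-cong 0ℙ e) (partᴿ-cong 0ℙ f)) (*-cong (partᴿ-cong 1ℙ e) (partᴿ-cong 1ℙ f))
  partᴿ-cong 1ℙ (*-cong e f) =
    +-cong (*-cong (partᴿ-cong 0ℙ e) (partᴿ-cong 1ℙ f)) (*-cong (partᴿ-cong 1ℙ e) (partᴿ-cong 0ℙ f))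
  partᴿ-cong 0ℙ (-‿cong e) = -‿cong (partᴿ-cong 0ℙ e)
  partᴿ-cong 1ℙ (-‿cong e) = -‿cong (partᴿ-cong 1ℙ e)
  partᴿ-cong 0ℙ (+-assoc x y z) = +-assoc _ _ _
  partᴿ-cong 1ℙ (+-assoc x y z) = +-assoc _ _ _
  partᴿ-cong 0ℙ (+-comm x y) = +-comm _ _
  partᴿ-cong 1ℙ (+-comm x y) = +-comm _ _
  partᴿ-cong 0ℙ (+-identityˡ x) = +-identityˡ _
  partᴿ-cong 1ℙ (+-identityˡ x) = +-identityˡ _
  partᴿ-cong 0ℙ (-‿inverseˡ x) = -‿inverseˡ _
  partᴿ-cong 1ℙ (-‿inverseˡ x) = -‿inverseˡ _
  partᴿ-cong 0ℙ (*-assoc x y z) = assoc-lemma _ _ _ _ _ _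
  partᴿ-cong 1ℙ (*-assoc x y z) = assoc-lemma _ _ _ _ _ _
  partᴿ-cong 0ℙ (*-identityˡ x) = trans (kill₂ refl) (*-identityˡ _)
  partᴿ-cong 1ℙ (*-identityˡ x) = trans (kill₂ refl) (*-identityˡ _)
  partᴿ-cong 0ℙ (distribˡ x y z) =
    trans (+-cong (distribˡ _ _ _) (distribˡ _ _ _)) (PR.interchange _ _ _ _)
  partᴿ-cong 1ℙ (distribˡ x y z) =
    trans (+-cong (distribˡ _ _ _) (distribˡ _ _ _)) (PR.interchange _ _ _ _)
  partᴿ-cong 0ℙ (distribʳ x y z) =
    trans (+-cong (distribʳ _ _ _) (distribʳ _ _ _)) (PR.interchange _ _ _ _)
  partᴿ-cong 1ℙ (distribʳ x y z) =
    trans (+-cong (distribʳ _ _ _) (distribʳ _ _ _)) (PR.interchange _ _ _ _)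
  partᴿ-cong 0ℙ (con-+ p q) = con-+ p q
  partᴿ-cong 1ℙ (con-+ p q) = sym 0+0
  partᴿ-cong 0ℙ (con-* p q) = trans (con-* p q) (sym (kill₂ refl))
  partᴿ-cong 1ℙ (con-* p q) = sym (trans (kill₂ refl) (PR.zeroʳ _))
  partᴿ-cong 0ℙ (con-central q x) =
    trans (kill₂ refl) (trans (con-central q _) (sym (kill₂ʳ refl)))
  partᴿ-cong 1ℙ (con-central q x) =
    trans (kill₂ refl) (trans (con-central q _) (sym (kill₁ʳ refl)))
  partᴿ-cong 0ℙ (θ-anticomm i≢j) =
    trans (kill₁ refl) (trans (θ-anticomm i≢j) (-‿cong (sym (kill₁ refl))))
  partᴿ-cong 1ℙ (θ-anticomm i≢j) = trans (trans (kill₁ refl) (PR.zeroʳ _))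
    (sym (trans (-‿cong (trans (kill₁ refl) (PR.zeroʳ _))) PR.-0#≈0#))
  partᴿ-cong 0ℙ (θ-square i) = trans (kill₁ refl) (θ-square i)
  partᴿ-cong 1ℙ (θ-square i) = trans (kill₁ refl) (PR.zeroʳ _)

  private
    neg-zero : ∀ {x} → x ≈ con 0ℚ → -ᴿ x ≈ con 0ℚ
    neg-zero e = trans (-‿cong e) PR.-0#≈0#

    sum-lemma : ∀ x₀ x₁ y₀ y₁ →
      (x₀ *ᴿ y₀ +ᴿ x₁ *ᴿ y₁) +ᴿ (x₀ *ᴿ y₁ +ᴿ x₁ *ᴿ y₀) ≈ (x₀ +ᴿ x₁) *ᴿ (y₀ +ᴿ y₁)
    sum-lemma x₀ x₁ y₀ y₁ = begin
      (x₀ *ᴿ y₀ +ᴿ x₁ *ᴿ y₁) +ᴿ (x₀ *ᴿ y₁ +ᴿ x₁ *ᴿ y₀)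
        ≈⟨ PR.interchange _ _ _ _ ⟩
      (x₀ *ᴿ y₀ +ᴿ x₀ *ᴿ y₁) +ᴿ (x₁ *ᴿ y₁ +ᴿ x₁ *ᴿ y₀)
        ≈⟨ +-cong (sym (distribˡ _ _ _)) (trans (+-comm _ _) (sym (distribˡ _ _ _))) ⟩
      x₀ *ᴿ (y₀ +ᴿ y₁) +ᴿ x₁ *ᴿ (y₀ +ᴿ y₁)
        ≈⟨ distribʳ _ _ _ ⟨
      (x₀ +ᴿ x₁) *ᴿ (y₀ +ᴿ y₁) ∎

  partᴿ-sum : ∀ x → partᴿ 0ℙ x +ᴿ partᴿ 1ℙ x ≈ x
  partᴿ-sum (con q)  = PR.+-identityʳ _
  partᴿ-sum (θ i)    = +-identityˡ _
  partᴿ-sum (x +ᴿ y) = trans (PR.interchange _ _ _ _) (+-cong (partᴿ-sum x) (partᴿ-sum y))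
  partᴿ-sum (x *ᴿ y) = trans (sum-lemma _ _ _ _) (*-cong (partᴿ-sum x) (partᴿ-sum y))
  partᴿ-sum (-ᴿ x)   = trans (PR.-‿+-comm _ _) (-‿cong (partᴿ-sum x))

  partᴿ-disjoint : ∀ p x → partᴿ (p ℙ.⁻¹) (partᴿ p x) ≈ con 0ℚ
  partᴿ-disjoint 0ℙ (con q)  = refl
  partᴿ-disjoint 1ℙ (con q)  = refl
  partᴿ-disjoint 0ℙ (θ i)    = refl
  partᴿ-disjoint 1ℙ (θ i)    = refl
  partᴿ-disjoint 0ℙ (x +ᴿ y) = trans (+-cong (partᴿ-disjoint 0ℙ x) (partᴿ-disjoint 0ℙ y)) 0+0
  partᴿ-disjoint 1ℙ (x +ᴿ y) = trans (+-cong (partᴿ-disjoint 1ℙ x) (partᴿ-disjoint 1ℙ y)) 0+0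
  partᴿ-disjoint 0ℙ (x *ᴿ y) = trans (+-cong
    (trans (kill₂ (partᴿ-disjoint 0ℙ x))
           (trans (*-cong refl (partᴿ-disjoint 0ℙ y)) (PR.zeroʳ _)))
    (trans (kill₁ (partᴿ-disjoint 1ℙ x))
           (trans (*-cong refl (partᴿ-disjoint 1ℙ y)) (PR.zeroʳ _)))) 0+0
  partᴿ-disjoint 1ℙ (x *ᴿ y) = trans (+-cong
    (trans (kill₂ (partᴿ-disjoint 0ℙ x))
           (trans (*-cong refl (partᴿ-disjoint 1ℙ y)) (PR.zeroʳ _)))
    (trans (kill₁ (partᴿ-disjoint 1ℙ x))
           (trans (*-cong refl (partᴿ-disjoint 0ℙ y)) (PR.zeroʳ _)))) 0+0
  partᴿ-disjoint 0ℙ (-ᴿ x)   = neg-zero (partᴿ-disjoint 0ℙ x)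
  partᴿ-disjoint 1ℙ (-ᴿ x)   = neg-zero (partᴿ-disjoint 1ℙ x)

  R : Superalgebra
  R = record
    { algebra = polyAlgebra
    ; part = partᴿ
    ; part-cong = partᴿ-cong
    ; part-+ = λ { 0ℙ x y → refl ; 1ℙ x y → refl }
    ; part-* = λ { 0ℙ x y → refl ; 1ℙ x y → refl }
    ; part-ι = λ q → refl
    ; part-sum = partᴿ-sum
    ; part-disjoint = partᴿ-disjoint
    }

  private
    partᴿ-mul : ∀ p q {x y} → partᴿ (p ℙ.⁻¹) x ≈ con 0ℚ → partᴿ (q ℙ.⁻¹) y ≈ con 0ℚ →
                partᴿ ((p ℙ.+ q) ℙ.⁻¹) (x *ᴿ y) ≈ con 0ℚ
    partᴿ-mul 0ℙ 0ℙ u v = trans (kill₂ u) (trans (*-cong refl v) (PR.zeroʳ _))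
    partᴿ-mul 0ℙ 1ℙ u v = trans (kill₂ u) (trans (*-cong refl v) (PR.zeroʳ _))
    partᴿ-mul 1ℙ 0ℙ u v = trans (kill₁ u) (trans (*-cong refl v) (PR.zeroʳ _))
    partᴿ-mul 1ℙ 1ℙ u v = trans (kill₁ u) (trans (*-cong refl v) (PR.zeroʳ _))

  partᴿ-homogeneous : ∀ {d x} → Homogeneous d x → partᴿ (ℕ.parity d ℙ.⁻¹) x ≈ con 0ℚ
  partᴿ-homogeneous (con q) = refl
  partᴿ-homogeneous (θ i) = refl
  partᴿ-homogeneous {d} zero with ℕ.parity d
  ... | 0ℙ = refl
  ... | 1ℙ = refl
  partᴿ-homogeneous {d} (add h k)
    with ℕ.parity d | partᴿ-homogeneous h | partᴿ-homogeneous k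
  ... | 0ℙ | e | f = trans (+-cong e f) 0+0
  ... | 1ℙ | e | f = trans (+-cong e f) 0+0
  partᴿ-homogeneous (mul {d} {e} {x} {y} h k) rewrite +-homo-+ d e =
    partᴿ-mul (ℕ.parity d) (ℕ.parity e) (partᴿ-homogeneous h) (partᴿ-homogeneous k)
  partᴿ-homogeneous {d} (neg h) with ℕ.parity d | partᴿ-homogeneous h
  ... | 0ℙ | e = neg-zero e
  ... | 1ℙ | e = neg-zero e
  partᴿ-homogeneous (resp e h) = trans (partᴿ-cong _ (sym e)) (partᴿ-homogeneous h)

  SymmetricOfNonzeroDegree : Poly n → Set
  SymmetricOfNonzeroDegree x = Symmetric x × ∃ λ d → d ≢ 0 × Homogeneous d x

  module J = Ideal R SymmetricOfNonzeroDegree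

  J-homogeneous : ∀ p {x} → SymmetricOfNonzeroDegree x → J.⟨ partᴿ p x ⟩
  J-homogeneous p {x} s@(_ , d , _ , h) with ℕ.parity d | partᴿ-homogeneous h
  J-homogeneous 0ℙ {x} s | 0ℙ | e =
    J.resp (trans (sym (partᴿ-sum x)) (trans (+-cong refl e) (PR.+-identityʳ _))) (J.gen s)
  J-homogeneous 1ℙ {x} s | 0ℙ | e = J.resp (sym e) J.zero
  J-homogeneous 0ℙ {x} s | 1ℙ | e = J.resp (sym e) J.zero
  J-homogeneous 1ℙ {x} s | 1ℙ | e =
    J.resp (trans (sym (partᴿ-sum x)) (trans (+-cong e refl) (+-identityˡ _))) (J.gen s)

  R/J : Superalgebra
  R/J = J.quotient J-homogeneous

  private
    act-part : ∀ (σ : Permutation′ n) p x → act σ (partᴿ p x) ≡ partᴿ p (act σ x)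
    act-part σ 0ℙ (con q)  = ≡.refl
    act-part σ 1ℙ (con q)  = ≡.refl
    act-part σ 0ℙ (θ i)    = ≡.refl
    act-part σ 1ℙ (θ i)    = ≡.refl
    act-part σ 0ℙ (x +ᴿ y) = ≡.cong₂ _+ᴿ_ (act-part σ 0ℙ x) (act-part σ 0ℙ y)
    act-part σ 1ℙ (x +ᴿ y) = ≡.cong₂ _+ᴿ_ (act-part σ 1ℙ x) (act-part σ 1ℙ y)
    act-part σ 0ℙ (x *ᴿ y) = ≡.cong₂ _+ᴿ_
      (≡.cong₂ _*ᴿ_ (act-part σ 0ℙ x) (act-part σ 0ℙ y))
      (≡.cong₂ _*ᴿ_ (act-part σ 1ℙ x) (act-part σ 1ℙ y))
    act-part σ 1ℙ (x *ᴿ y) = ≡.cong₂ _+ᴿ_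
      (≡.cong₂ _*ᴿ_ (act-part σ 0ℙ x) (act-part σ 1ℙ y))
      (≡.cong₂ _*ᴿ_ (act-part σ 1ℙ x) (act-part σ 0ℙ y))
    act-part σ 0ℙ (-ᴿ x)   = ≡.cong -ᴿ_ (act-part σ 0ℙ x)
    act-part σ 1ℙ (-ᴿ x)   = ≡.cong -ᴿ_ (act-part σ 1ℙ x)

  symRing : Ring 0ℓ 0ℓ
  symRing = record
    { Carrier = Σ (Poly n) Symmetric
    ; _≈_ = λ s t → proj₁ s ≈ proj₁ t
    ; _+_ = λ (x , s) (y , t) → x +ᴿ y , λ σ → +-cong (s σ) (t σ)
    ; _*_ = λ (x , s) (y , t) → x *ᴿ y , λ σ → *-cong (s σ) (t σ)
    ; -_ = λ (x , s) → -ᴿ x , λ σ → -‿cong (s σ)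
    ; 0# = con 0ℚ , λ σ → refl
    ; 1# = con 1ℚ , λ σ → refl
    ; isRing = RingMono.isRing isMono PR.isRing
    }
    where
    isMono : IsRingMonomorphism _ PR.rawRing proj₁
    isMono = record
      { isRingHomomorphism = record
        { isSemiringHomomorphism = record
          { isNearSemiringHomomorphism = record
            { +-isMonoidHomomorphism = record
              { isMagmaHomomorphism = record
                { isRelHomomorphism = record { cong = λ e → e }
                ; homo = λ _ _ → refl }
              ; ε-homo = refl }
            ; *-homo = λ _ _ → refl }
          ; 1#-homo = refl }
        ; -‿homo = λ _ → refl }
      ; injective = λ e → e }

  Sym : Superalgebra
  Sym = record
    { algebra = record
      { ring = symRing
      ; ι = λ q → con q , λ σ → refl
      ; ι-isRingHomomorphism = record
        { isSemiringHomomorphism = record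
          { isNearSemiringHomomorphism = record
            { +-isMonoidHomomorphism = record
              { isMagmaHomomorphism = record
                { isRelHomomorphism = record { cong = λ { ≡.refl → refl } }
                ; homo = con-+ }
              ; ε-homo = refl }
            ; *-homo = con-* }
          ; 1#-homo = refl }
        ; -‿homo = con-neg }
      ; ι-central = λ q (x , _) → con-central q x
      }
    ; part = λ p (x , s) → partᴿ p x ,
        λ σ → trans (PR.reflexive (act-part σ p x)) (partᴿ-cong p (s σ))
    ; part-cong = λ p → partᴿ-cong p
    ; part-+ = λ { 0ℙ x y → refl ; 1ℙ x y → refl }
    ; part-* = λ { 0ℙ x y → refl ; 1ℙ x y → refl }
    ; part-ι = λ q → refl
    ; part-sum = λ (x , _) → partᴿ-sum x
    ; part-disjoint = λ p (x , _) → partᴿ-disjoint p x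
    }

  R-over-Sym : LeftModule symRing 0ℓ 0ℓ
  R-over-Sym = record
    { Carrierᴹ = Poly n
    ; _≈ᴹ_ = _≈_
    ; _+ᴹ_ = _+ᴿ_
    ; _*ₗ_ = λ (s , _) x → s *ᴿ x
    ; 0ᴹ = con 0ℚ
    ; -ᴹ_ = -ᴿ_
    ; isLeftModule = record
      { isLeftSemimodule = record
        { +ᴹ-isCommutativeMonoid = PR.+-isCommutativeMonoid
        ; isPreleftSemimodule = record
          { *ₗ-cong = *-cong
          ; *ₗ-zeroˡ = PR.zeroˡ
          ; *ₗ-distribʳ = λ x (s , _) (t , _) → distribʳ x s t
          ; *ₗ-identityˡ = *-identityˡ
          ; *ₗ-assoc = λ (s , _) (t , _) x → *-assoc s t x
          ; *ₗ-zeroʳ = λ (s , _) → PR.zeroʳ s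
          ; *ₗ-distribˡ = λ (s , _) x y → distribˡ s x y
          }
        }
      ; -ᴹ‿cong = -‿cong
      ; -ᴹ‿inverse = -‿inverseˡ , PR.-‿inverseʳ
      }
    }

-- For b a linear form and u a vector, x ↦ x + b ∂ᵤ x is the substitution
-- θₖ ↦ θₖ + uₖ b, where ∂ᵤ is the antiderivation with ∂ᵤ θₖ = uₖ. Transpositions are
-- of this kind, so a symmetric x satisfies ∂ᵢ x = ∂₀ x for all i. This forces
-- ∂ᵢ ∂₀ x = ∂ᵢ ∂ᵢ x = 0, hence x = a + b F, and conversely.
--
-- Freeness: the monomials in θ₁, …, θₘ form a basis over the symmetric elements. The
-- operators ∂ᵢ - ∂₀ kill F, hence are semilinear over the symmetric elements, and
-- composing them with multiplications by θᵢ reads off coefficients one variable at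
-- a time; what remains is killed by all ∂ᵢ - ∂₀, i.e. symmetric.
--
-- Isomorphism: the substitution θ₀ ↦ θ₀ - F kills J and is a section of the projection
-- to R/J. Multiplying it with the inclusion of the symmetric elements gives the inverse
-- of the homomorphism θ₀ ↦ θ₀ ⊗ 1 + 1 ⊗ F, θᵢ ↦ θᵢ ⊗ 1 for i ≥ 1.

module Submission where

open import Defs using (module Superalgebra; _≅_; _⊗_; IsFree; R; R/J; Sym; R-over-Sym)
open import Data.Nat.Base using (ℕ; NonZero)
open import Data.Product.Base using (_×_)

open import Defs
  using (Algebra; Poly; _≈ᴿ_; module _≈ᴿ_; module Poly; act; act-cong; Symmetric;
         Homogeneous; module Homogeneous; module J; module Tensor; IsBasis)
open Poly using (con; θ; _+ᴿ_; _*ᴿ_; -ᴿ_)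
import Algebra.Properties.CommutativeMonoid.Sum as CommutativeMonoidSum
import Algebra.Properties.Ring as RingProperties
import Algebra.Properties.Semiring.Sum as SemiringSum
open import Data.Bool.Base using (Bool; true; false)
import Data.Bool.Properties as Bool
open import Data.Fin.Base using (Fin; zero; suc; punchIn)
open import Data.Fin.Permutation using (transpose; _⟨$⟩ʳ_)
open import Data.Fin.Properties using (_≟_; punchInᵢ≢i)
import Data.List.Base as List
open List using (List; []; _∷_)
open import Data.List.Membership.Propositional using () renaming (_∈_ to _∈ˡ_)
open import Data.List.Membership.Propositional.Properties using (∈-allFin)
open import Data.List.Relation.Unary.Any using (here; there)
open import Data.Nat.Base as ℕ using (zero; suc; ≢-nonZero⁻¹)
open import Data.Parity.Base using (0ℙ; 1ℙ)
open import Data.Product.Base using (∃; _,_; proj₁; proj₂)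
import Data.Rational.Base as ℚ
open ℚ using (ℚ; 0ℚ; 1ℚ; ½)
import Data.Rational.Properties as ℚ
open import Data.Sum.Base as Sum using (_⊎_; inj₁; inj₂)
open import Data.Vec.Base using (Vec; []; _∷_; allFin)
open import Data.Vec.Membership.Propositional using (_∈_)
open import Data.Vec.Membership.Propositional.Properties using (∈-allFin⁺)
open import Data.Vec.Relation.Unary.All using (All; []; _∷_)
open import Data.Vec.Relation.Unary.AllPairs using ([]; _∷_)
open import Data.Vec.Relation.Unary.Any using (here; there)
open import Data.Vec.Relation.Unary.Unique.Propositional using (Unique)
open import Data.Vec.Relation.Unary.Unique.Propositional.Properties using (tabulate⁺)
open import Function.Base using (id; _∘_)
open import Function.Definitions using (Injective)
open import Relation.Binary.PropositionalEquality as ≡ using (_≡_; _≢_)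
import Relation.Binary.Reasoning.Setoid as SetoidReasoning
open import Relation.Nullary using (yes; no)
open import Relation.Nullary.Negation using (contradiction)

module ≈ᴿ = _≈ᴿ_

-- Halving in algebras over ℚ

module AlgebraLemmas (A : Algebra) where
  open Algebra A
  open RingProperties ring
  open SetoidReasoning setoid

  halve : ∀ x → x ≈ ι ½ * (x + x)
  halve x = begin
    x                   ≈⟨ *-identityˡ x ⟨
    1# * x              ≈⟨ *-congʳ ι.1#-homo ⟨
    ι (½ ℚ.+ ½) * x     ≈⟨ *-congʳ (ι.+-homo ½ ½) ⟩
    (ι ½ + ι ½) * x     ≈⟨ distribʳ x _ _ ⟩
    ι ½ * x + ι ½ * x   ≈⟨ distribˡ _ x x ⟨
    ι ½ * (x + x)       ∎

  -- Since 2 is invertible, an anticommutation law with two equal arguments forces a square to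
  -- vanish. This yields the relation `θ-square` in `Lift`, `∂-square`, and b² = 0 for forms.
  x≈-x⇒x≈0 : ∀ {x} → x ≈ - x → x ≈ 0#
  x≈-x⇒x≈0 {x} e = begin
    x              ≈⟨ halve x ⟩
    ι ½ * (x + x)  ≈⟨ *-congˡ (trans (+-congˡ e) (-‿inverseʳ x)) ⟩
    ι ½ * 0#       ≈⟨ zeroʳ _ ⟩
    0#             ∎

-- Homomorphisms out of the polynomial ring

module _ {n : ℕ} (A : Algebra) where
  open Algebra A

  record IsHom (f : Poly n → Carrier) : Set where
    field
      cong   : ∀ {x y} → _≈ᴿ_ n x y → f x ≈ f y
      +-homo : ∀ x y → f (x +ᴿ y) ≈ f x + f y
      *-homo : ∀ x y → f (x *ᴿ y) ≈ f x * f y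
      -‿homo : ∀ x → f (-ᴿ x) ≈ - f x
      con-homo : ∀ q → f (con q) ≈ ι q

  -- Constants and variables generate all expressions, so an identity between substitutions only has
  -- to be checked on the variables.
  hom-ext : ∀ {f g} → IsHom f → IsHom g → (∀ i → f (θ i) ≈ g (θ i)) → ∀ x → f x ≈ g x
  hom-ext {f} {g} F G e = go
    where
    module F = IsHom F
    module G = IsHom G
    go : ∀ x → f x ≈ g x
    go (con q)  = trans (F.con-homo q) (sym (G.con-homo q))
    go (θ i)    = e i
    go (x +ᴿ y) = trans (F.+-homo x y) (trans (+-cong (go x) (go y)) (sym (G.+-homo x y)))
    go (x *ᴿ y) = trans (F.*-homo x y) (trans (*-cong (go x) (go y)) (sym (G.*-homo x y)))
    go (-ᴿ x)   = trans (F.-‿homo x) (trans (-‿cong (go x)) (sym (G.-‿homo x)))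

  -- The hypothesis includes `i` equal to `j` and thereby covers both families of relations: an
  -- element equal to its own negative is zero.
  module Lift (t : Fin n → Carrier) (anticomm : ∀ i j → t i * t j ≈ - (t j * t i)) where

    lift : Poly n → Carrier
    lift (con q)  = ι q
    lift (θ i)    = t i
    lift (x +ᴿ y) = lift x + lift y
    lift (x *ᴿ y) = lift x * lift y
    lift (-ᴿ x)   = - lift x

    lift-cong : ∀ {x y} → _≈ᴿ_ n x y → lift x ≈ lift y
    lift-cong ≈ᴿ.refl              = refl
    lift-cong (≈ᴿ.sym e)           = sym (lift-cong e)
    lift-cong (≈ᴿ.trans e f)       = trans (lift-cong e) (lift-cong f)
    lift-cong (≈ᴿ.+-cong e f)      = +-cong (lift-cong e) (lift-cong f)
    lift-cong (≈ᴿ.*-cong e f)      = *-cong (lift-cong e) (lift-cong f)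
    lift-cong (≈ᴿ.-‿cong e)        = -‿cong (lift-cong e)
    lift-cong (≈ᴿ.+-assoc _ _ _)   = +-assoc _ _ _
    lift-cong (≈ᴿ.+-comm _ _)      = +-comm _ _
    lift-cong (≈ᴿ.+-identityˡ _)   = trans (+-congʳ ι.0#-homo) (+-identityˡ _)
    lift-cong (≈ᴿ.-‿inverseˡ _)    = trans (-‿inverseˡ _) (sym ι.0#-homo)
    lift-cong (≈ᴿ.*-assoc _ _ _)   = *-assoc _ _ _
    lift-cong (≈ᴿ.*-identityˡ _)   = trans (*-congʳ ι.1#-homo) (*-identityˡ _)
    lift-cong (≈ᴿ.distribˡ _ _ _)  = distribˡ _ _ _
    lift-cong (≈ᴿ.distribʳ _ _ _)  = distribʳ _ _ _
    lift-cong (≈ᴿ.con-+ p q)       = ι.+-homo p q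
    lift-cong (≈ᴿ.con-* p q)       = ι.*-homo p q
    lift-cong (≈ᴿ.con-central q _) = ι-central q _
    lift-cong (≈ᴿ.θ-anticomm _)    = anticomm _ _
    lift-cong (≈ᴿ.θ-square i)      =
      trans (AlgebraLemmas.x≈-x⇒x≈0 A (anticomm i i)) (sym ι.0#-homo)

    lift-isHom : IsHom lift
    lift-isHom = record
      { cong = lift-cong
      ; +-homo = λ _ _ → refl
      ; *-homo = λ _ _ → refl
      ; -‿homo = λ _ → refl
      ; con-homo = λ _ → refl
      }

-- The row `δ i` is a coordinate vector, so `∂ (δ i)` is the partial derivative in `θ i`. Recursion
-- on the indices makes entries such as `δ zero (suc j)` reduce by computation, which later proofs
-- rely on.
δ : ∀ {n} → Fin n → Fin n → ℚ
δ zero    zero    = 1ℚ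
δ zero    (suc _) = 0ℚ
δ (suc _) zero    = 0ℚ
δ (suc i) (suc j) = δ i j

δ-refl : ∀ {n} (i : Fin n) → δ i i ≡ 1ℚ
δ-refl zero    = ≡.refl
δ-refl (suc i) = δ-refl i

δ-≢ : ∀ {n} {i j : Fin n} → i ≢ j → δ i j ≡ 0ℚ
δ-≢ {i = zero}  {zero}  i≢j = contradiction ≡.refl i≢j
δ-≢ {i = zero}  {suc j} i≢j = ≡.refl
δ-≢ {i = suc i} {zero}  i≢j = ≡.refl
δ-≢ {i = suc i} {suc j} i≢j = δ-≢ (λ e → i≢j (≡.cong suc e))

-- Antiderivations of the exterior algebra

module Derivations {n : ℕ} where
  open Superalgebra (R n) hiding (zero)
  open AlgebraLemmas algebra public
  open SetoidReasoning setoid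

  -- The grade involution, which acts as (-1)^d in degree d.
  σ : Poly n → Poly n
  σ = sign 1ℙ

  σ-‿ : ∀ x → σ (- x) ≈ - σ x
  σ-‿ x = -‿+-comm _ _

  σ-con : ∀ q → σ (con q) ≈ con q
  σ-con = sign-ι 1ℙ

  σ-θ : ∀ i → σ (θ i) ≈ - θ i
  σ-θ i = +-identityˡ _

  σ-isHom : IsHom algebra σ
  σ-isHom = record
    { cong = sign-cong 1ℙ ; +-homo = sign-+ 1ℙ ; *-homo = sign-* 1ℙ
    ; -‿homo = σ-‿ ; con-homo = σ-con }

  con-cong : ∀ {p q} → p ≡ q → con p ≈ con q
  con-cong e = reflexive (≡.cong con e)

  -- Contraction with the vector `u`. Having `σ x` in the product rule supplies the sign for `x` of
  -- mixed parity as well.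
  ∂ : (Fin n → ℚ) → Poly n → Poly n
  ∂ u (con q)  = 0#
  ∂ u (θ j)    = con (u j)
  ∂ u (x +ᴿ y) = ∂ u x + ∂ u y
  ∂ u (x *ᴿ y) = ∂ u x * y + σ x * ∂ u y
  ∂ u (-ᴿ x)   = - ∂ u x

  private
    +-0ʳ : ∀ {x y} → y ≈ 0# → x + y ≈ x
    +-0ʳ e = trans (+-congˡ e) (+-identityʳ _)

    +-0ˡ : ∀ {x y} → x ≈ 0# → x + y ≈ y
    +-0ˡ e = trans (+-congʳ e) (+-identityˡ _)

    ∂-θθ : ∀ u i j → ∂ u (θ i * θ j) ≈ con (u i) * θ j - con (u j) * θ i
    ∂-θθ u i j = +-congˡ (begin
      σ (θ i) * con (u j)  ≈⟨ *-congʳ (σ-θ i) ⟩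
      - θ i * con (u j)    ≈⟨ -‿distribˡ-* _ _ ⟨
      - (θ i * con (u j))  ≈⟨ -‿cong (ι-central _ _) ⟨
      - (con (u j) * θ i)  ∎)

  -- Associativity holds because `σ` is multiplicative, centrality of constants because `σ` fixes
  -- them. For the relations between variables, `∂-θθ` gives a derivative that is antisymmetric in
  -- `i` and `j`.
  ∂-cong : ∀ u {x y} → x ≈ y → ∂ u x ≈ ∂ u y
  ∂-cong u ≈ᴿ.refl              = refl
  ∂-cong u (≈ᴿ.sym e)           = sym (∂-cong u e)
  ∂-cong u (≈ᴿ.trans e f)       = trans (∂-cong u e) (∂-cong u f)
  ∂-cong u (≈ᴿ.+-cong e f)      = +-cong (∂-cong u e) (∂-cong u f)
  ∂-cong u (≈ᴿ.*-cong e f)      =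
    +-cong (*-cong (∂-cong u e) f) (*-cong (sign-cong 1ℙ e) (∂-cong u f))
  ∂-cong u (≈ᴿ.-‿cong e)        = -‿cong (∂-cong u e)
  ∂-cong u (≈ᴿ.+-assoc _ _ _)   = +-assoc _ _ _
  ∂-cong u (≈ᴿ.+-comm _ _)      = +-comm _ _
  ∂-cong u (≈ᴿ.+-identityˡ _)   = +-identityˡ _
  ∂-cong u (≈ᴿ.-‿inverseˡ _)    = -‿inverseˡ _
  ∂-cong u (≈ᴿ.*-assoc x y z)   = begin
    (∂ u x * y + σ x * ∂ u y) * z + σ (x * y) * ∂ u z
      ≈⟨ +-cong (trans (distribʳ _ _ _) (+-cong (*-assoc _ _ _) (*-assoc _ _ _)))
                (trans (*-congʳ (sign-* 1ℙ x y)) (*-assoc _ _ _)) ⟩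
    ∂ u x * (y * z) + σ x * (∂ u y * z) + σ x * (σ y * ∂ u z)
      ≈⟨ trans (+-assoc _ _ _) (+-congˡ (sym (distribˡ _ _ _))) ⟩
    ∂ u x * (y * z) + σ x * (∂ u y * z + σ y * ∂ u z) ∎
  ∂-cong u (≈ᴿ.*-identityˡ x)   = trans (+-0ˡ (zeroˡ _)) (trans (*-congʳ (σ-con 1ℚ)) (*-identityˡ _))
  ∂-cong u (≈ᴿ.distribˡ x y z)  = trans (+-cong (distribˡ _ _ _) (distribˡ _ _ _)) (interchange _ _ _ _)
  ∂-cong u (≈ᴿ.distribʳ x y z)  = trans
    (+-cong (distribʳ _ _ _) (trans (*-congʳ (sign-+ 1ℙ y z)) (distribʳ _ _ _)))
    (interchange _ _ _ _)
  ∂-cong u (≈ᴿ.con-+ p q)       = sym (+-identityˡ _)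
  ∂-cong u (≈ᴿ.con-* p q)       = sym (trans (+-0ˡ (zeroˡ _)) (zeroʳ _))
  ∂-cong u (≈ᴿ.con-central q x) = begin
    0# * x + σ (con q) * ∂ u x  ≈⟨ +-0ˡ (zeroˡ _) ⟩
    σ (con q) * ∂ u x           ≈⟨ *-congʳ (σ-con q) ⟩
    con q * ∂ u x               ≈⟨ ι-central q _ ⟩
    ∂ u x * con q               ≈⟨ +-0ʳ (zeroʳ _) ⟨
    ∂ u x * con q + σ x * 0#    ∎
  ∂-cong u (≈ᴿ.θ-anticomm {i} {j} _) = begin
    ∂ u (θ i * θ j)                         ≈⟨ ∂-θθ u i j ⟩
    con (u i) * θ j - con (u j) * θ i       ≈⟨ ⁻¹-anti-homo‿- _ _ ⟨
    - (con (u j) * θ i - con (u i) * θ j)   ≈⟨ -‿cong (∂-θθ u j i) ⟨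
    - ∂ u (θ j * θ i)                       ∎
  ∂-cong u (≈ᴿ.θ-square i)      = trans (∂-θθ u i i) (-‿inverseʳ _)

  -- Contraction lowers the degree by one, so it flips the parity.
  ∂-σ : ∀ u x → ∂ u (σ x) ≈ - σ (∂ u x)
  ∂-σ u (con q)  = trans (+-identityˡ _) (sym (-‿cong (σ-con 0ℚ)))
  ∂-σ u (θ i)    = trans (+-identityˡ _) (sym (-‿cong (σ-con _)))
  ∂-σ u (x +ᴿ y) = begin
    ∂ u (σ (x + y))             ≈⟨ ∂-cong u (sign-+ 1ℙ x y) ⟩
    ∂ u (σ x) + ∂ u (σ y)       ≈⟨ +-cong (∂-σ u x) (∂-σ u y) ⟩
    - σ (∂ u x) - σ (∂ u y)     ≈⟨ -‿+-comm _ _ ⟩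
    - (σ (∂ u x) + σ (∂ u y))   ≈⟨ -‿cong (sign-+ 1ℙ _ _) ⟨
    - σ (∂ u x + ∂ u y)         ∎
  ∂-σ u (x *ᴿ y) = begin
    ∂ u (σ (x * y))
      ≈⟨ ∂-cong u (sign-* 1ℙ x y) ⟩
    ∂ u (σ x) * σ y + σ (σ x) * ∂ u (σ y)
      ≈⟨ +-cong (*-congʳ (∂-σ u x)) (*-congˡ (∂-σ u y)) ⟩
    - σ (∂ u x) * σ y + σ (σ x) * - σ (∂ u y)
      ≈⟨ +-cong (-‿distribˡ-* _ _) (-‿distribʳ-* _ _) ⟨
    - (σ (∂ u x) * σ y) - σ (σ x) * σ (∂ u y)
      ≈⟨ -‿+-comm _ _ ⟩
    - (σ (∂ u x) * σ y + σ (σ x) * σ (∂ u y))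
      ≈⟨ -‿cong (trans (sign-+ 1ℙ (∂ u x * y) (σ x * ∂ u y))
                      (+-cong (sign-* 1ℙ (∂ u x) y) (sign-* 1ℙ (σ x) (∂ u y)))) ⟨
    - σ (∂ u x * y + σ x * ∂ u y) ∎
  ∂-σ u (-ᴿ x)   = begin
    ∂ u (σ (- x))    ≈⟨ ∂-cong u (σ-‿ x) ⟩
    - ∂ u (σ x)      ≈⟨ -‿cong (∂-σ u x) ⟩
    - - σ (∂ u x)    ≈⟨ -‿cong (σ-‿ _) ⟨
    - σ (- ∂ u x)    ∎

  -- For a product, the two terms with both operators on the same factor follow by induction. The
  -- two mixed terms trade places, each with a sign from `∂-σ`.
  ∂-∂ : ∀ u v x → ∂ u (∂ v x) ≈ - ∂ v (∂ u x)
  ∂-∂ u v (con q)  = sym -0#≈0#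
  ∂-∂ u v (θ i)    = sym -0#≈0#
  ∂-∂ u v (x +ᴿ y) = trans (+-cong (∂-∂ u v x) (∂-∂ u v y)) (-‿+-comm _ _)
  ∂-∂ u v (x *ᴿ y) = begin
    (∂ u (∂ v x) * y + σ (∂ v x) * ∂ u y) + (∂ u (σ x) * ∂ v y + σ (σ x) * ∂ u (∂ v y))
      ≈⟨ +-cong (+-congʳ (*-congʳ (∂-∂ u v x)))
                (+-cong (*-congʳ (∂-σ u x)) (*-congˡ (∂-∂ u v y))) ⟩
    (- ∂ v (∂ u x) * y + σ (∂ v x) * ∂ u y) + (- σ (∂ u x) * ∂ v y + σ (σ x) * - ∂ v (∂ u y))
      ≈⟨ +-cong (+-cong (sym (-‿distribˡ-* _ _)) (sym lemma))
                (+-cong (sym (-‿distribˡ-* _ _)) (sym (-‿distribʳ-* _ _))) ⟩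
    (- (∂ v (∂ u x) * y) - ∂ v (σ x) * ∂ u y) + (- (σ (∂ u x) * ∂ v y) - σ (σ x) * ∂ v (∂ u y))
      ≈⟨ interchange _ _ _ _ ⟩
    (- (∂ v (∂ u x) * y) - σ (∂ u x) * ∂ v y) + (- (∂ v (σ x) * ∂ u y) - σ (σ x) * ∂ v (∂ u y))
      ≈⟨ +-cong (-‿+-comm _ _) (-‿+-comm _ _) ⟩
    - (∂ v (∂ u x) * y + σ (∂ u x) * ∂ v y) - (∂ v (σ x) * ∂ u y + σ (σ x) * ∂ v (∂ u y))
      ≈⟨ -‿+-comm _ _ ⟩
    - ∂ v (∂ u (x * y)) ∎
    where
    lemma : - (∂ v (σ x) * ∂ u y) ≈ σ (∂ v x) * ∂ u y
    lemma = begin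
      - (∂ v (σ x) * ∂ u y)      ≈⟨ -‿distribˡ-* _ _ ⟩
      - ∂ v (σ x) * ∂ u y        ≈⟨ *-congʳ (-‿cong (∂-σ v x)) ⟩
      - - σ (∂ v x) * ∂ u y      ≈⟨ *-congʳ (-‿involutive _) ⟩
      σ (∂ v x) * ∂ u y          ∎
  ∂-∂ u v (-ᴿ x)   = -‿cong (∂-∂ u v x)

  ∂-square : ∀ u x → ∂ u (∂ u x) ≈ 0#
  ∂-square u x = x≈-x⇒x≈0 (∂-∂ u u x)

  -- Linearity in the vector makes a difference of two contractions a single contraction, to which
  -- `∂-square` and `∂-∂` apply.
  ∂-minus : ∀ u v x → ∂ (λ k → u k ℚ.- v k) x ≈ ∂ u x - ∂ v x
  ∂-minus u v (con q)  = sym (-‿inverseʳ _)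
  ∂-minus u v (θ i)    = trans (ι.+-homo _ _) (+-congˡ (ι.-‿homo _))
  ∂-minus u v (x +ᴿ y) = begin
    ∂ _ x + ∂ _ y                             ≈⟨ +-cong (∂-minus u v x) (∂-minus u v y) ⟩
    (∂ u x - ∂ v x) + (∂ u y - ∂ v y)         ≈⟨ interchange _ _ _ _ ⟩
    (∂ u x + ∂ u y) + (- ∂ v x - ∂ v y)       ≈⟨ +-congˡ (-‿+-comm _ _) ⟩
    (∂ u x + ∂ u y) - (∂ v x + ∂ v y)         ∎
  ∂-minus u v (x *ᴿ y) = begin
    ∂ _ x * y + σ x * ∂ _ y
      ≈⟨ +-cong (*-congʳ (∂-minus u v x)) (*-congˡ (∂-minus u v y)) ⟩
    (∂ u x - ∂ v x) * y + σ x * (∂ u y - ∂ v y)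
      ≈⟨ +-cong ([y-z]x≈yx-zx _ _ _) (x[y-z]≈xy-xz _ _ _) ⟩
    (∂ u x * y - ∂ v x * y) + (σ x * ∂ u y - σ x * ∂ v y)
      ≈⟨ interchange _ _ _ _ ⟩
    (∂ u x * y + σ x * ∂ u y) + (- (∂ v x * y) - σ x * ∂ v y)
      ≈⟨ +-congˡ (-‿+-comm _ _) ⟩
    (∂ u x * y + σ x * ∂ u y) - (∂ v x * y + σ x * ∂ v y) ∎
  ∂-minus u v (-ᴿ x)   = trans (-‿cong (∂-minus u v x)) (sym (-‿+-comm _ _))

-- Odd elements and substitutions of shear type

module Shears {n : ℕ} where
  open Superalgebra (R n) hiding (zero)
  open Derivations {n}
  open SetoidReasoning setoid

  -- The two properties of linear forms on which shears rest. They are stable under sums, negation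
  -- and scalars, so no degrees have to be tracked.
  record IsForm (b : Poly n) : Set where
    field
      swap : ∀ x → x * b ≈ b * σ x
      odd  : σ b ≈ - b

    square : b * b ≈ 0#
    square = x≈-x⇒x≈0 (trans (swap b) (trans (*-congˡ odd) (sym (-‿distribʳ-* b b))))

  open IsForm

  private
    θ-swap : ∀ i x → x * θ i ≈ θ i * σ x
    θ-swap i (con q)  = trans (ι-central q _) (*-congˡ (sym (σ-con q)))
    θ-swap i (θ j)    = trans (lemma (i ≟ j)) (sym (trans (*-congˡ (σ-θ j)) (sym (-‿distribʳ-* _ _))))
      where
      lemma : _ → θ j * θ i ≈ - (θ i * θ j)
      lemma (yes ≡.refl) = trans (≈ᴿ.θ-square i) (sym (trans (-‿cong (≈ᴿ.θ-square i)) -0#≈0#))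
      lemma (no i≢j)     = ≈ᴿ.θ-anticomm (i≢j ∘ ≡.sym)
    θ-swap i (x +ᴿ y) = begin
      (x + y) * θ i             ≈⟨ distribʳ _ _ _ ⟩
      x * θ i + y * θ i         ≈⟨ +-cong (θ-swap i x) (θ-swap i y) ⟩
      θ i * σ x + θ i * σ y     ≈⟨ distribˡ _ _ _ ⟨
      θ i * (σ x + σ y)         ≈⟨ *-congˡ (sign-+ 1ℙ x y) ⟨
      θ i * σ (x + y)           ∎
    θ-swap i (x *ᴿ y) = begin
      (x * y) * θ i             ≈⟨ *-assoc _ _ _ ⟩
      x * (y * θ i)             ≈⟨ *-congˡ (θ-swap i y) ⟩
      x * (θ i * σ y)           ≈⟨ *-assoc _ _ _ ⟨
      (x * θ i) * σ y           ≈⟨ *-congʳ (θ-swap i x) ⟩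
      (θ i * σ x) * σ y         ≈⟨ *-assoc _ _ _ ⟩
      θ i * (σ x * σ y)         ≈⟨ *-congˡ (sign-* 1ℙ x y) ⟨
      θ i * σ (x * y)           ∎
    θ-swap i (-ᴿ x)   = begin
      - x * θ i                 ≈⟨ -‿distribˡ-* _ _ ⟨
      - (x * θ i)               ≈⟨ -‿cong (θ-swap i x) ⟩
      - (θ i * σ x)             ≈⟨ -‿distribʳ-* _ _ ⟩
      θ i * - σ x               ≈⟨ *-congˡ (σ-‿ x) ⟨
      θ i * σ (- x)             ∎

  θ-form : ∀ i → IsForm (θ i)
  θ-form i = record { swap = θ-swap i ; odd = σ-θ i }

  *-swap : ∀ {b} c → IsForm b → b * c ≈ σ c * b
  *-swap c B = trans (*-congˡ (sym (sign-sign c))) (sym (swap B (σ c)))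

  +-form : ∀ {b c} → IsForm b → IsForm c → IsForm (b + c)
  +-form {b} {c} B C = record
    { swap = λ x → trans (distribˡ _ _ _)
        (trans (+-cong (swap B x) (swap C x)) (sym (distribʳ _ _ _)))
    ; odd  = trans (sign-+ 1ℙ b c) (trans (+-cong (odd B) (odd C)) (-‿+-comm _ _))
    }

  -‿form : ∀ {b} → IsForm b → IsForm (- b)
  -‿form {b} B = record
    { swap = λ x → trans (sym (-‿distribʳ-* _ _))
        (trans (-‿cong (swap B x)) (-‿distribˡ-* _ _))
    ; odd  = trans (σ-‿ b) (-‿cong (odd B))
    }

  scale-form : ∀ {b} → IsForm b → ∀ q → IsForm (b * con q)
  scale-form {b} B q = record
    { swap = λ x → begin
        x * (b * con q)       ≈⟨ *-assoc _ _ _ ⟨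
        (x * b) * con q       ≈⟨ *-congʳ (swap B x) ⟩
        (b * σ x) * con q     ≈⟨ *-assoc _ _ _ ⟩
        b * (σ x * con q)     ≈⟨ *-congˡ (ι-central q _) ⟨
        b * (con q * σ x)     ≈⟨ *-assoc _ _ _ ⟨
        (b * con q) * σ x     ∎
    ; odd  = begin
        σ (b * con q)         ≈⟨ sign-* 1ℙ b (con q) ⟩
        σ b * σ (con q)       ≈⟨ *-cong (odd B) (σ-con q) ⟩
        - b * con q           ≈⟨ -‿distribˡ-* _ _ ⟨
        - (b * con q)         ∎
    }

  0-form : IsForm 0#
  0-form = record
    { swap = λ x → trans (zeroʳ x) (sym (zeroˡ _))
    ; odd  = trans (σ-con 0ℚ) (sym -0#≈0#)
    }

  ∂-form-* : ∀ {b} u x → IsForm b → ∂ u (b * x) ≈ ∂ u b * x - b * ∂ u x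
  ∂-form-* u x B = +-congˡ (trans (*-congʳ (odd B)) (sym (-‿distribˡ-* _ _)))

  -- The substitution θ k ↦ θ k + u k b: its Taylor expansion stops here because b² = 0.
  shear : Poly n → (Fin n → ℚ) → Poly n → Poly n
  shear b u x = x + b * ∂ u x

  shear-0 : ∀ b u {x} → ∂ u x ≈ 0# → shear b u x ≈ x
  shear-0 b u e = trans (+-congˡ (trans (*-congˡ e) (zeroʳ _))) (+-identityʳ _)

  -- Expanding a product of two shears, the terms linear in `b` assemble to the product rule of
  -- `∂ u`. In the quadratic term the two copies of `b` can be brought together, where b² = 0.
  shear-isHom : ∀ {b} u → IsForm b → IsHom algebra (shear b u)
  shear-isHom {b} u B = record
    { cong = λ e → +-cong e (*-congˡ (∂-cong u e))
    ; +-homo = λ x y → trans (+-congˡ (distribˡ _ _ _)) (interchange _ _ _ _)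
    ; *-homo = *-homo
    ; -‿homo = λ x → trans (+-congˡ (sym (-‿distribʳ-* _ _))) (-‿+-comm _ _)
    ; con-homo = λ q → shear-0 b u refl
    }
    where
    *-homo : ∀ x y → shear b u (x * y) ≈ shear b u x * shear b u y
    *-homo x y = sym (begin
      (x + b * ∂ u x) * (y + b * ∂ u y)
        ≈⟨ trans (distribʳ _ _ _) (+-cong (distribˡ _ _ _) (distribˡ _ _ _)) ⟩
      (x * y + x * (b * ∂ u y)) + ((b * ∂ u x) * y + (b * ∂ u x) * (b * ∂ u y))
        -- Moving `b` to the front past `x` produces exactly the `σ x` of the product rule.
        ≈⟨ +-cong (+-congˡ (trans (sym (*-assoc _ _ _)) (trans (*-congʳ (swap B x)) (*-assoc _ _ _))))
                  (trans (+-congˡ vanish) (trans (+-identityʳ _) (*-assoc _ _ _))) ⟩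
      (x * y + b * (σ x * ∂ u y)) + b * (∂ u x * y)
        ≈⟨ trans (+-assoc _ _ _) (+-congˡ (trans (+-comm _ _) (sym (distribˡ _ _ _)))) ⟩
      x * y + b * (∂ u x * y + σ x * ∂ u y) ∎)
      where
      vanish : (b * ∂ u x) * (b * ∂ u y) ≈ 0#
      vanish = begin
        (b * ∂ u x) * (b * ∂ u y)     ≈⟨ *-assoc _ _ _ ⟨
        ((b * ∂ u x) * b) * ∂ u y     ≈⟨ *-congʳ (*-assoc _ _ _) ⟩
        (b * (∂ u x * b)) * ∂ u y     ≈⟨ *-congʳ (*-congˡ (swap B _)) ⟩
        (b * (b * σ (∂ u x))) * ∂ u y ≈⟨ *-congʳ (*-assoc _ _ _) ⟨
        ((b * b) * σ (∂ u x)) * ∂ u y ≈⟨ *-congʳ (trans (*-congʳ (square B)) (zeroˡ _)) ⟩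
        0# * ∂ u y                    ≈⟨ zeroˡ _ ⟩
        0#                            ∎

  id-isHom : IsHom algebra id
  id-isHom = record { cong = id ; +-homo = λ _ _ → refl ; *-homo = λ _ _ → refl
                    ; -‿homo = λ _ → refl ; con-homo = λ _ → refl }

  ∘-isHom : ∀ {A} {f : Poly n → Algebra.Carrier A} {g : Poly n → Poly n} →
    IsHom A f → IsHom algebra g → IsHom A (f ∘ g)
  ∘-isHom {A} {f} {g} F G = record
    { cong     = λ e → F.cong (G.cong e)
    ; +-homo   = λ x y → A.trans (F.cong (G.+-homo x y)) (F.+-homo _ _)
    ; *-homo   = λ x y → A.trans (F.cong (G.*-homo x y)) (F.*-homo _ _)
    ; -‿homo   = λ x → A.trans (F.cong (G.-‿homo x)) (F.-‿homo _)
    ; con-homo = λ q → A.trans (F.cong (G.con-homo q)) (F.con-homo q)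
    }
    where
    module A = Algebra A
    module F = IsHom F
    module G = IsHom G

  -- Elements all of whose derivatives vanish

  aug : Poly n → ℚ
  aug (con q)  = q
  aug (θ i)    = 0ℚ
  aug (x +ᴿ y) = aug x ℚ.+ aug y
  aug (x *ᴿ y) = aug x ℚ.* aug y
  aug (-ᴿ x)   = ℚ.- aug x

  -- Setting all variables to zero respects the relations because it is a lift; `aug` computes the
  -- rational number that this leaves.
  open Lift algebra (λ (_ : Fin n) → 0#)
    (λ i j → trans (zeroˡ 0#) (sym (trans (-‿cong (zeroˡ 0#)) -0#≈0#)))
    public using () renaming (lift to vanish; lift-isHom to vanish-isHom)

  vanish≈aug : ∀ x → vanish x ≈ con (aug x)
  vanish≈aug (con q)  = refl
  vanish≈aug (θ i)    = refl
  vanish≈aug (x +ᴿ y) = trans (+-cong (vanish≈aug x) (vanish≈aug y)) (sym (ι.+-homo _ _))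
  vanish≈aug (x *ᴿ y) = trans (*-cong (vanish≈aug x) (vanish≈aug y)) (sym (ι.*-homo _ _))
  vanish≈aug (-ᴿ x)   = trans (-‿cong (vanish≈aug x)) (sym (ι.-‿homo _))

  -- The substitution of 0 for `θ i` that fixes the other variables. Written as a shear, it visibly
  -- fixes every element killed by `∂ (δ i)`.
  eraser : Fin n → Poly n → Poly n
  eraser i = shear (- θ i) (δ i)

  eraser-isHom : ∀ i → IsHom algebra (eraser i)
  eraser-isHom i = shear-isHom (δ i) (-‿form (θ-form i))

  eraser-θ : ∀ i → eraser i (θ i) ≈ 0#
  eraser-θ i = begin
    θ i + - θ i * con (δ i i)  ≈⟨ +-congˡ (*-congˡ (con-cong (δ-refl i))) ⟩
    θ i + - θ i * 1#           ≈⟨ +-congˡ (*-identityʳ _) ⟩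
    θ i - θ i                  ≈⟨ -‿inverseʳ _ ⟩
    0#                         ∎

  erase : List (Fin n) → Poly n → Poly n
  erase []      = id
  erase (i ∷ l) = erase l ∘ eraser i

  erase-isHom : ∀ l → IsHom algebra (erase l)
  erase-isHom []      = id-isHom
  erase-isHom (i ∷ l) = ∘-isHom (erase-isHom l) (eraser-isHom i)

  erase-id : ∀ {x} → (∀ i → ∂ (δ i) x ≈ 0#) → ∀ l → erase l x ≈ x
  erase-id e []      = refl
  erase-id e (i ∷ l) = trans (IsHom.cong (erase-isHom l) (shear-0 (- θ i) (δ i) (e i))) (erase-id e l)

  erase-θ : ∀ {i l} → i ∈ˡ l → erase l (θ i) ≈ 0#
  erase-θ {i} {j ∷ l} i∈ with j ≟ i
  ... | yes ≡.refl = trans (E.cong (eraser-θ i)) (E.con-homo 0ℚ)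
    where module E = IsHom (erase-isHom l)
  erase-θ {i} {j ∷ l} (here i≡j)  | no j≢i = contradiction (≡.sym i≡j) j≢i
  erase-θ {i} {j ∷ l} (there i∈l) | no j≢i = trans
    (IsHom.cong (erase-isHom l) (shear-0 (- θ j) (δ j) (con-cong (δ-≢ j≢i))))
    (erase-θ i∈l)

  -- Erasing the variables one after another never changes `x`, because each correction term
  -- contains a derivative of `x`. The result is nevertheless the substitution of 0 for every
  -- variable.
  ∂≈0⇒constant : ∀ {x} → (∀ i → ∂ (δ i) x ≈ 0#) → x ≈ con (aug x)
  ∂≈0⇒constant {x} e = begin
    x                  ≈⟨ erase-id e (List.allFin n) ⟨
    erase (List.allFin n) x ≈⟨ hom-ext algebra (erase-isHom (List.allFin n)) vanish-isHom
                            (λ i → erase-θ (∈-allFin i)) x ⟩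
    vanish x           ≈⟨ vanish≈aug x ⟩
    con (aug x)        ∎

  -- The invariant F and the transpositions

  open SemiringSum semiring public
    using (sum; sum-cong-≋; sum-replicate-zero; *-distribˡ-sum)
  open CommutativeMonoidSum +-commutativeMonoid public using (sum-permute; sum-remove)

  sum-form : ∀ {k} {b : Fin k → Poly n} → (∀ i → IsForm (b i)) → IsForm (sum b)
  sum-form {zero}  B = 0-form
  sum-form {suc k} B = +-form (B zero) (sum-form (B ∘ suc))

  sum-con-δ : ∀ {k} (i : Fin k) → sum (λ j → con (δ i j)) ≈ 1#
  sum-con-δ {suc k} zero    = trans (+-congˡ (sum-replicate-zero k)) (+-identityʳ 1#)
  sum-con-δ         (suc i) = trans (+-identityˡ _) (sum-con-δ i)

  ∂-sum : ∀ {k} u (f : Fin k → Poly n) → ∂ u (sum f) ≡ sum (∂ u ∘ f)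
  ∂-sum {zero}  u f = ≡.refl
  ∂-sum {suc k} u f = ≡.cong (∂ u (f zero) +_) (∂-sum u (f ∘ suc))

  F : Poly n
  F = sum θ

  F-form : IsForm F
  F-form = sum-form θ-form

  ∂F : ∀ i → ∂ (δ i) F ≈ 1#
  ∂F i = trans (reflexive (∂-sum (δ i) θ)) (sum-con-δ i)

  act-isHom : ∀ π → IsHom algebra (act π)
  act-isHom π = record { cong = act-cong π ; +-homo = λ _ _ → refl ; *-homo = λ _ _ → refl
                       ; -‿homo = λ _ → refl ; con-homo = λ _ → refl }

  act-sum : ∀ {k} π (f : Fin k → Poly n) → act π (sum f) ≡ sum (act π ∘ f)
  act-sum {zero}  π f = ≡.refl
  act-sum {suc k} π f = ≡.cong (act π (f zero) +_) (act-sum π (f ∘ suc))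

  F-symmetric : Symmetric F
  F-symmetric π = sym (trans (sum-permute θ π) (reflexive (≡.sym (act-sum π θ))))

  -- A transposition is the reflection along θᵢ - θⱼ: the coefficient of the shear is 1 at `i`, -1
  -- at `j` and 0 at every other variable.
  transpose-shear : ∀ {i j} → i ≢ j → ∀ x →
    act (transpose i j) x ≈ shear (- (θ i - θ j)) (λ k → δ i k ℚ.- δ j k) x
  transpose-shear {i} {j} i≢j = hom-ext algebra (act-isHom (transpose i j))
    (shear-isHom _ (-‿form (+-form (θ-form i) (-‿form (θ-form j))))) on-θ
    where
    b : Poly n
    b = - (θ i - θ j)
    on-θ : ∀ k → θ (transpose i j ⟨$⟩ʳ k) ≈ θ k + b * con (δ i k ℚ.- δ j k)
    on-θ k with k ≟ i
    ... | yes ≡.refl rewrite δ-refl i | δ-≢ (i≢j ∘ ≡.sym) = sym (begin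
      θ i + b * 1#             ≈⟨ +-congˡ (trans (*-identityʳ b) (⁻¹-anti-homo‿- _ _)) ⟩
      θ i + (θ j - θ i)        ≈⟨ +-assoc _ _ _ ⟨
      θ i + θ j - θ i          ≈⟨ xyx⁻¹≈y _ _ ⟩
      θ j                      ∎)
    ... | no k≢i with k ≟ j
    ... | yes ≡.refl rewrite δ-refl j | δ-≢ i≢j = sym (begin
      θ j + b * con (0ℚ ℚ.- 1ℚ)  ≈⟨ +-congˡ lemma ⟩
      θ j + (θ i - θ j)        ≈⟨ +-assoc _ _ _ ⟨
      θ j + θ i - θ j          ≈⟨ xyx⁻¹≈y _ _ ⟩
      θ i                      ∎)
      where
      lemma : b * con (0ℚ ℚ.- 1ℚ) ≈ θ i - θ j
      lemma = begin
        b * con (ℚ.- 1ℚ)    ≈⟨ *-congˡ (ι.-‿homo 1ℚ) ⟩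
        b * - 1#            ≈⟨ -‿distribʳ-* _ _ ⟨
        - (b * 1#)          ≈⟨ -‿cong (*-identityʳ b) ⟩
        - b                 ≈⟨ -‿involutive _ ⟩
        θ i - θ j           ∎
    ... | no k≢j rewrite δ-≢ (k≢i ∘ ≡.sym) | δ-≢ (k≢j ∘ ≡.sym) =
      sym (trans (+-congˡ (zeroʳ b)) (+-identityʳ _))

  -- Invariance under (i j) reads b ∂ x = 0 for b = θ j - θ i and ∂ = ∂ᵢ - ∂ⱼ;
  -- applying ∂ once more turns this into -2 ∂ x = 0.
  symmetric⇒∂≈∂ : ∀ {x} → Symmetric x → ∀ i j → ∂ (δ i) x ≈ ∂ (δ j) x
  symmetric⇒∂≈∂ {x} s i j with i ≟ j
  ... | yes ≡.refl = refl
  ... | no i≢j = x∙y⁻¹≈ε⇒x≈y _ _ (trans (sym (∂-minus (δ i) (δ j) x)) y≈0)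
    where
    u : Fin n → ℚ
    u k = δ i k ℚ.- δ j k
    b y : Poly n
    b = - (θ i - θ j)
    y = ∂ u x
    b-form : IsForm b
    b-form = -‿form (+-form (θ-form i) (-‿form (θ-form j)))
    by≈0 : b * y ≈ 0#
    by≈0 = +-cancelˡ x _ _ (begin
      x + b * y                   ≈⟨ transpose-shear i≢j x ⟨
      act (transpose i j) x       ≈⟨ s (transpose i j) ⟩
      x                           ≈⟨ +-identityʳ x ⟨
      x + 0#                      ∎)
    ∂b : ∂ u b ≈ - (1# + 1#)
    ∂b = -‿cong (+-cong (con-cong ui) (trans (-‿cong (trans (con-cong uj) (ι.-‿homo 1ℚ))) (-‿involutive 1#)))
      where
      ui : u i ≡ 1ℚ
      ui rewrite δ-refl i | δ-≢ (i≢j ∘ ≡.sym) = ≡.refl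
      uj : u j ≡ ℚ.- 1ℚ
      uj rewrite δ-refl j | δ-≢ i≢j = ≡.refl
    2y≈0 : y + y ≈ 0#
    2y≈0 = -‿injective (begin
      - (y + y)                   ≈⟨ -‿cong (trans (distribʳ _ _ _) (+-cong (*-identityˡ y) (*-identityˡ y))) ⟨
      - ((1# + 1#) * y)           ≈⟨ -‿distribˡ-* _ _ ⟩
      - (1# + 1#) * y             ≈⟨ *-congʳ ∂b ⟨
      ∂ u b * y                   ≈⟨ +-identityʳ _ ⟨
      ∂ u b * y + 0#              ≈⟨ +-congˡ (trans (-‿cong (trans (*-congˡ (∂-square u x)) (zeroʳ b))) -0#≈0#) ⟨
      ∂ u b * y - b * ∂ u y       ≈⟨ ∂-form-* u y b-form ⟨
      ∂ u (b * y)                 ≈⟨ ∂-cong u by≈0 ⟩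
      0#                          ≈⟨ -0#≈0# ⟨
      - 0#                        ∎)
    y≈0 : y ≈ 0#
    y≈0 = trans (halve y) (trans (*-congˡ 2y≈0) (zeroʳ _))

  affine-symmetric : ∀ {x} a b → x ≈ con a + con b * F → Symmetric x
  affine-symmetric a b e π =
    trans (act-cong π e) (trans (+-congˡ (*-congˡ (F-symmetric π))) (sym e))

-- Splitting off F, and the shape of symmetric elements

module Splitting (m : ℕ) where
  private n = suc m
  open Superalgebra (R n) hiding (zero)
  open Derivations {n}
  open Shears {n}
  open SetoidReasoning setoid

  -- The substitution θ₀ ↦ θ₀ - F, which sends F to 0 and is the identity modulo F.
  split : Poly n → Poly n
  split = shear (- F) (δ zero)

  split-isHom : IsHom algebra split
  split-isHom = shear-isHom (δ zero) (-‿form F-form)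

  x≈split+F∂ : ∀ x → x ≈ split x + F * ∂ (δ zero) x
  x≈split+F∂ x = sym (trans (+-assoc _ _ _) (trans (+-congˡ
    (trans (+-congʳ (sym (-‿distribˡ-* _ _))) (-‿inverseˡ _))) (+-identityʳ x)))

  -- In the decomposition `x≈split+F∂` both `split x` and ∂₀ x are constants. All derivatives of ∂₀
  -- x vanish because ∂ᵢ ∂₀ x = ∂ᵢ ∂ᵢ x; and since ∂ᵢ F = 1, the derivative of the correction term
  -- in `split x` is -∂₀ x, which cancels ∂ᵢ x.
  ∂≈∂⇒affine : ∀ {x} → (∀ i → ∂ (δ i) x ≈ ∂ (δ zero) x) →
               ∃ λ a → ∃ λ b → x ≈ con a + con b * F
  ∂≈∂⇒affine {x} e = a , b , (begin
    x                         ≈⟨ x≈split+F∂ x ⟩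
    split x + F * ∂₀ x        ≈⟨ +-cong (∂≈0⇒constant ∂split≈0) (*-congˡ (∂≈0⇒constant ∂∂≈0)) ⟩
    con a + F * con b         ≈⟨ +-congˡ (ι-central b F) ⟨
    con a + con b * F         ∎)
    where
    ∂₀ : Poly n → Poly n
    ∂₀ = ∂ (δ zero)
    a b : ℚ
    a = aug (split x)
    b = aug (∂₀ x)
    ∂∂≈0 : ∀ i → ∂ (δ i) (∂₀ x) ≈ 0#
    ∂∂≈0 i = trans (∂-cong (δ i) (sym (e i))) (∂-square (δ i) x)
    ∂split≈0 : ∀ i → ∂ (δ i) (split x) ≈ 0#
    ∂split≈0 i = begin
      ∂ (δ i) x + ∂ (δ i) (- F * ∂₀ x)
        ≈⟨ +-congˡ (∂-form-* (δ i) (∂₀ x) (-‿form F-form)) ⟩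
      ∂ (δ i) x + (∂ (δ i) (- F) * ∂₀ x - - F * ∂ (δ i) (∂₀ x))
        ≈⟨ +-cong (e i) (+-cong (trans (*-congʳ (-‿cong (∂F i))) (-1*x≈-x _))
             (trans (-‿cong (trans (*-congˡ (∂∂≈0 i)) (zeroʳ _))) -0#≈0#)) ⟩
      ∂₀ x + (- ∂₀ x + 0#)
        ≈⟨ trans (+-congˡ (+-identityʳ _)) (-‿inverseʳ _) ⟩
      0# ∎

  symmetric⇒affine : ∀ {x} → Symmetric x → ∃ λ a → ∃ λ b → x ≈ con a + con b * F
  symmetric⇒affine s = ∂≈∂⇒affine (λ i → symmetric⇒∂≈∂ s i zero)

-- Freeness: extracting one variable at a time

module Freeness (m : ℕ) where
  private n = suc m
  open Superalgebra (R n) hiding (zero)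
  open Derivations {n}
  open Shears {n}
  open Splitting m
  open IsForm
  open SetoidReasoning setoid
  private module S = Superalgebra (Sym n)

  -- The operator ∂ᵢ₊₁ - ∂₀. The index set `Fin m` stands for the variables other than `θ zero`,
  -- hence the shift by `suc`.
  ∇ : Fin m → Poly n → Poly n
  ∇ i = ∂ (λ k → δ (suc i) k ℚ.- δ zero k)

  ∇-cong : ∀ i {x y} → x ≈ y → ∇ i x ≈ ∇ i y
  ∇-cong i = ∂-cong _

  ∇-symmetric : ∀ i (c : S.Carrier) → ∇ i (proj₁ c) ≈ 0#
  ∇-symmetric i (c , s) = trans (∂-minus _ _ c) (x≈y⇒x∙y⁻¹≈ε (symmetric⇒∂≈∂ s (suc i) zero))

  ∇-θ* : ∀ i j x → ∇ i (θ (suc j) * x) ≈ con (δ i j) * x - θ (suc j) * ∇ i x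
  ∇-θ* i j x = trans (∂-form-* _ x (θ-form (suc j)))
    (+-congʳ (*-congʳ (con-cong (ℚ.+-identityʳ (δ i j)))))

  ∇-θ*-≢ : ∀ {i j} x → i ≢ j → ∇ i (θ (suc j) * x) ≈ - (θ (suc j) * ∇ i x)
  ∇-θ*-≢ {i} {j} x i≢j = trans (∇-θ* i j x)
    (trans (+-congʳ (trans (*-congʳ (con-cong (δ-≢ i≢j))) (zeroˡ x))) (+-identityˡ _))

  ∇-θ*-≡ : ∀ i x → ∇ i (θ (suc i) * x) ≈ x - θ (suc i) * ∇ i x
  ∇-θ*-≡ i x = trans (∇-θ* i i x)
    (+-congʳ (trans (*-congʳ (con-cong (δ-refl i))) (*-identityˡ x)))

  -- With respect to `θ (suc i)`, `true` reads off the coefficient of the variable and `false` the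
  -- part without it. Both results lie in the kernel of `∇ i`, which plays the role of the elements
  -- free of that variable.
  extract : Bool → Fin m → Poly n → Poly n
  extract false i x = ∇ i (θ (suc i) * x)
  extract true  i x = ∇ i x

  factor : Bool → Fin m → Poly n
  factor false i = 1#
  factor true  i = θ (suc i)

  extract-cong : ∀ b i {x y} → x ≈ y → extract b i x ≈ extract b i y
  extract-cong false i e = ∇-cong i (*-congˡ e)
  extract-cong true  i e = ∇-cong i e

  extract-+ : ∀ b i x y → extract b i (x + y) ≈ extract b i x + extract b i y
  extract-+ false i x y = ∇-cong i (distribˡ _ x y)
  extract-+ true  i x y = refl

  -- This is the relation ∇θ + θ∇ = 1 between contraction and multiplication.
  extract-sum : ∀ x i → x ≈ extract false i x + θ (suc i) * extract true i x
  extract-sum x i = sym (begin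
    ∇ i (θ (suc i) * x) + θ (suc i) * ∇ i x                 ≈⟨ +-congʳ (∇-θ*-≡ i x) ⟩
    x - θ (suc i) * ∇ i x + θ (suc i) * ∇ i x               ≈⟨ +-assoc _ _ _ ⟩
    x + (- (θ (suc i) * ∇ i x) + θ (suc i) * ∇ i x)         ≈⟨ +-congˡ (-‿inverseˡ _) ⟩
    x + 0#                                                  ≈⟨ +-identityʳ x ⟩
    x                                                       ∎)

  ∇-extract-same : ∀ b i x → ∇ i (extract b i x) ≈ 0#
  ∇-extract-same false i x = ∂-square _ (θ (suc i) * x)
  ∇-extract-same true  i x = ∂-square _ x

  -- Extracting one variable does not undo earlier extractions: for distinct indices `∇ j`
  -- anticommutes both with `∇ i` and with multiplication by `θ (suc i)`.
  ∇-extract : ∀ b i {j x} → ∇ j x ≈ 0# → ∇ j (extract b i x) ≈ 0#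
  ∇-extract b i {j} {x} e with j ≟ i
  ... | yes ≡.refl = ∇-extract-same b i x
  ∇-extract false i {j} {x} e | no j≢i = begin
    ∇ j (∇ i (θ (suc i) * x))     ≈⟨ ∂-∂ _ _ (θ (suc i) * x) ⟩
    - ∇ i (∇ j (θ (suc i) * x))   ≈⟨ -‿cong (∇-cong i (∇-θ*-≢ x j≢i)) ⟩
    - ∇ i (- (θ (suc i) * ∇ j x)) ≈⟨ -‿cong (∇-cong i (trans (-‿cong (trans (*-congˡ e) (zeroʳ _))) -0#≈0#)) ⟩
    - 0#                          ≈⟨ -0#≈0# ⟩
    0#                            ∎
  ∇-extract true i {j} {x} e | no j≢i =
    trans (∂-∂ _ _ x) (trans (-‿cong (∇-cong i e)) -0#≈0#)

  extract-factor : ∀ b i {y} → ∇ i y ≈ 0# → extract b i (factor b i * y) ≈ y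
  extract-factor false i {y} e = begin
    ∇ i (θ (suc i) * (1# * y))    ≈⟨ ∇-cong i (*-congˡ (*-identityˡ y)) ⟩
    ∇ i (θ (suc i) * y)           ≈⟨ ∇-θ*-≡ i y ⟩
    y - θ (suc i) * ∇ i y         ≈⟨ +-congˡ (trans (-‿cong (trans (*-congˡ e) (zeroʳ _))) -0#≈0#) ⟩
    y + 0#                        ≈⟨ +-identityʳ y ⟩
    y                             ∎
  extract-factor true i {y} e = trans (∇-θ*-≡ i y)
    (trans (+-congˡ (trans (-‿cong (trans (*-congˡ e) (zeroʳ _))) -0#≈0#)) (+-identityʳ y))

  extract-factor-≢ : ∀ {a b} i {y} → a ≢ b → ∇ i y ≈ 0# → extract a i (factor b i * y) ≈ 0#
  extract-factor-≢ {false} {false} i a≢b e = contradiction ≡.refl a≢b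
  extract-factor-≢ {true}  {true}  i a≢b e = contradiction ≡.refl a≢b
  extract-factor-≢ {false} {true}  i {y} a≢b e = ∇-cong i
    (trans (sym (*-assoc _ _ _)) (trans (*-congʳ (≈ᴿ.θ-square (suc i))) (zeroˡ y)))
  extract-factor-≢ {true}  {false} i {y} a≢b e = trans (∇-cong i (*-identityˡ y)) e

  -- The change that a symmetric coefficient undergoes when it is moved past `factor b i` or out of
  -- `extract b i`.
  twist : Bool → S.Carrier → S.Carrier
  twist false c = c
  twist true  c = S.sign 1ℙ c

  twist-injective : ∀ b c → twist b c S.≈ S.0# → c S.≈ S.0#
  twist-injective false c e = e
  twist-injective true  c e = trans (sym (sign-sign (proj₁ c))) (trans (sign-cong 1ℙ e) (σ-con 0ℚ))

  -- Symmetric elements are killed by `∇ i`, so `∇ i` passes them at the cost of one `σ`. In the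
  -- case `false` the multiplication by `θ (suc i)` costs a second `σ`, and the two cancel.
  extract-* : ∀ b i (c : S.Carrier) x →
    extract b i (proj₁ c * x) ≈ proj₁ (twist b c) * extract b i x
  extract-* false i c x = begin
    ∇ i (θ (suc i) * (proj₁ c * x))
      ≈⟨ ∇-cong i (trans (sym (*-assoc _ _ _))
           (trans (*-congʳ (*-swap (proj₁ c) (θ-form (suc i)))) (*-assoc _ _ _))) ⟩
    ∇ i (σ (proj₁ c)) * (θ (suc i) * x) + σ (σ (proj₁ c)) * ∇ i (θ (suc i) * x)
      ≈⟨ +-cong (trans (*-congʳ (∇-symmetric i (S.sign 1ℙ c))) (zeroˡ _)) (*-congʳ (sign-sign (proj₁ c))) ⟩
    0# + proj₁ c * ∇ i (θ (suc i) * x)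
      ≈⟨ +-identityˡ _ ⟩
    proj₁ c * ∇ i (θ (suc i) * x) ∎
  extract-* true i c x = trans (+-congʳ (trans (*-congʳ (∇-symmetric i c)) (zeroˡ x))) (+-identityˡ _)

  -- Monomials and the operators reading off their coefficients

  monomial : ∀ {l} → Vec (Fin m) l → Vec Bool l → Poly n
  monomial []      []      = 1#
  monomial (i ∷ v) (b ∷ s) = factor b i * monomial v s

  coefficient : ∀ {l} → Vec (Fin m) l → Vec Bool l → Poly n → Poly n
  coefficient []      []      x = x
  coefficient (i ∷ v) (b ∷ s) x = coefficient v s (extract b i x)

  twists : ∀ {l} → Vec Bool l → S.Carrier → S.Carrier
  twists []      c = c
  twists (b ∷ s) c = twists s (twist b c)

  twists-injective : ∀ {l} (s : Vec Bool l) c → twists s c S.≈ S.0# → c S.≈ S.0#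
  twists-injective []      c e = e
  twists-injective (b ∷ s) c e = twist-injective b c (twists-injective s (twist b c) e)

  coefficient-cong : ∀ {l} (v : Vec (Fin m) l) s {x y} → x ≈ y → coefficient v s x ≈ coefficient v s y
  coefficient-cong []      []      e = e
  coefficient-cong (i ∷ v) (b ∷ s) e = coefficient-cong v s (extract-cong b i e)

  coefficient-+ : ∀ {l} (v : Vec (Fin m) l) s x y →
    coefficient v s (x + y) ≈ coefficient v s x + coefficient v s y
  coefficient-+ []      []      x y = refl
  coefficient-+ (i ∷ v) (b ∷ s) x y =
    trans (coefficient-cong v s (extract-+ b i x y)) (coefficient-+ v s _ _)

  coefficient-0 : ∀ {l} (v : Vec (Fin m) l) s → coefficient v s 0# ≈ 0#
  coefficient-0 v s = x+x≈x⇒x≈0 _ (trans (sym (coefficient-+ v s 0# 0#)) (coefficient-cong v s (+-identityˡ 0#)))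

  coefficient-sum : ∀ {l} (v : Vec (Fin m) l) s {k} (f : Fin k → Poly n) →
    coefficient v s (sum f) ≈ sum (coefficient v s ∘ f)
  coefficient-sum v s {zero}  f = coefficient-0 v s
  coefficient-sum v s {suc k} f =
    trans (coefficient-+ v s _ _) (+-congˡ (coefficient-sum v s (f ∘ suc)))

  coefficient-* : ∀ {l} (v : Vec (Fin m) l) s c x →
    coefficient v s (proj₁ c * x) ≈ proj₁ (twists s c) * coefficient v s x
  coefficient-* []      []      c x = refl
  coefficient-* (i ∷ v) (b ∷ s) c x =
    trans (coefficient-cong v s (extract-* b i c x)) (coefficient-* v s (twist b c) _)

  ∇-monomial : ∀ {l} {v : Vec (Fin m) l} {i} → All (i ≢_) v → ∀ s → ∇ i (monomial v s) ≈ 0#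
  ∇-monomial []          []          = refl
  ∇-monomial (_ ∷ i∉v)   (false ∷ s) = trans (∇-cong _ (*-identityˡ _)) (∇-monomial i∉v s)
  ∇-monomial (i≢j ∷ i∉v) (true ∷ s)  = trans (∇-θ*-≢ _ i≢j)
    (trans (-‿cong (trans (*-congˡ (∇-monomial i∉v s)) (zeroʳ _))) -0#≈0#)

  coefficient-monomial : ∀ {l} {v : Vec (Fin m) l} → Unique v → ∀ s →
    coefficient v s (monomial v s) ≈ 1#
  coefficient-monomial             []        []      = refl
  coefficient-monomial {v = i ∷ v} (i∉v ∷ u) (b ∷ s) = trans
    (coefficient-cong v s (extract-factor b i (∇-monomial i∉v s)))
    (coefficient-monomial u s)

  -- Equal leading exponents are stripped; at the first position where the exponents differ,
  -- `extract-factor-≢` gives 0.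
  coefficient-monomial-≢ : ∀ {l} {v : Vec (Fin m) l} → Unique v → ∀ {s t} → s ≢ t →
    coefficient v s (monomial v t) ≈ 0#
  coefficient-monomial-≢             []        {[]}    {[]}    s≢t = contradiction ≡.refl s≢t
  coefficient-monomial-≢ {v = i ∷ v} (i∉v ∷ u) {a ∷ s} {b ∷ t} s≢t with a Bool.≟ b
  ... | yes ≡.refl = trans
    (coefficient-cong v s (extract-factor b i (∇-monomial i∉v t)))
    (coefficient-monomial-≢ u (s≢t ∘ ≡.cong (a ∷_)))
  ... | no a≢b = trans
    (coefficient-cong v s (extract-factor-≢ i a≢b (∇-monomial i∉v t)))
    (coefficient-0 v s)

  sum-0 : ∀ {k} (f : Fin k → Poly n) → (∀ i → f i ≈ 0#) → sum f ≈ 0#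
  sum-0 {k} f e = trans (sum-cong-≋ e) (sum-replicate-zero k)

  sum-single : ∀ {k} (f : Fin k → Poly n) j → (∀ i → i ≢ j → f i ≈ 0#) → sum f ≈ f j
  sum-single {suc k} f j e = trans (sum-remove {i = j} f) (trans
    (+-congˡ (sum-0 _ (λ i → e (punchIn j i) (punchInᵢ≢i j i)))) (+-identityʳ _))

  -- Reading off the coefficient at `f j` from the relation leaves only the term `j`, as `f` is
  -- injective. What remains is `c j` up to twists, which are invertible.
  monomial-independent : ∀ {l} {v : Vec (Fin m) l} → Unique v → ∀ k (f : Fin k → Vec Bool l) →
    Injective _≡_ _≡_ f → ∀ (c : Fin k → S.Carrier) →
    sum (λ i → proj₁ (c i) * monomial v (f i)) ≈ 0# → ∀ i → proj₁ (c i) ≈ 0#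
  monomial-independent {v = v} u k f f-inj c e j = twists-injective (f j) (c j) (begin
    proj₁ (twists (f j) (c j))
      ≈⟨ trans (*-congˡ (coefficient-monomial u (f j))) (*-identityʳ _) ⟨
    proj₁ (twists (f j) (c j)) * coefficient v (f j) (monomial v (f j))
      ≈⟨ sum-single _ j (λ i i≢j → trans
           (*-congˡ (coefficient-monomial-≢ u (i≢j ∘ ≡.sym ∘ f-inj))) (zeroʳ _)) ⟨
    sum (λ i → proj₁ (twists (f j) (c i)) * coefficient v (f j) (monomial v (f i)))
      ≈⟨ sum-cong-≋ (λ i → coefficient-* v (f j) (c i) _) ⟨
    sum (λ i → coefficient v (f j) (proj₁ (c i) * monomial v (f i)))
      ≈⟨ coefficient-sum v (f j) (λ i → proj₁ (c i) * monomial v (f i)) ⟨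
    coefficient v (f j) (sum (λ i → proj₁ (c i) * monomial v (f i)))
      ≈⟨ trans (coefficient-cong v (f j) e) (coefficient-0 v (f j)) ⟩
    0# ∎)

  -- Spanning by monomials

  Spanned : ∀ {l} → Vec (Fin m) l → Poly n → Set
  Spanned {l} v x = ∃ λ k → ∃ λ (f : Fin k → Vec Bool l) → ∃ λ (c : Fin k → S.Carrier) →
    x ≈ sum (λ i → proj₁ (c i) * monomial v (f i))

  spanned-cong : ∀ {l} {v : Vec (Fin m) l} {x y} → x ≈ y → Spanned v y → Spanned v x
  spanned-cong e (k , f , c , p) = k , f , c , trans e p

  spanned-sum+ : ∀ {l} {v : Vec (Fin m) l} {y} k (f : Fin k → Vec Bool l) (c : Fin k → S.Carrier) →
    Spanned v y → Spanned v (sum (λ i → proj₁ (c i) * monomial v (f i)) + y)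
  spanned-sum+ zero    f c q = spanned-cong (+-identityˡ _) q
  spanned-sum+ (suc k) f c q with spanned-sum+ k (f ∘ suc) (c ∘ suc) q
  ... | k′ , f′ , c′ , r = suc k′
    , (λ { zero → f zero ; (suc i) → f′ i })
    , (λ { zero → c zero ; (suc i) → c′ i })
    , trans (+-assoc _ _ _) (+-congˡ r)

  spanned-+ : ∀ {l} {v : Vec (Fin m) l} {x y} → Spanned v x → Spanned v y → Spanned v (x + y)
  spanned-+ (k , f , c , p) q = spanned-cong (+-congʳ p) (spanned-sum+ k f c q)

  -- The new factor arrives to the left of the coefficients and has to be moved past them, which
  -- twists each one.
  spanned-∷ : ∀ {l} {v : Vec (Fin m) l} {x} b i → Spanned v x → Spanned (i ∷ v) (factor b i * x)
  spanned-∷ {v = v} {x} b i (k , f , c , p) = k , (b ∷_) ∘ f , twist b ∘ c , (begin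
    factor b i * x
      ≈⟨ *-congˡ p ⟩
    factor b i * sum (λ j → proj₁ (c j) * monomial v (f j))
      ≈⟨ *-distribˡ-sum _ (λ j → proj₁ (c j) * monomial v (f j)) ⟩
    sum (λ j → factor b i * (proj₁ (c j) * monomial v (f j)))
      ≈⟨ sum-cong-≋ (λ j → trans (sym (*-assoc _ _ _)) (trans (*-congʳ (move b (c j))) (*-assoc _ _ _))) ⟩
    sum (λ j → proj₁ (twist b (c j)) * (factor b i * monomial v (f j))) ∎)
    where
    move : ∀ b c → factor b i * proj₁ c ≈ proj₁ (twist b c) * factor b i
    move false c = ι-central 1ℚ _
    move true  c = *-swap (proj₁ c) (θ-form (suc i))

  -- Induction on the variables still to be extracted. The hypothesis is the invariant: each
  -- variable is either still pending or already removed.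
  monomial-spanning : ∀ {l} (v : Vec (Fin m) l) x → (∀ i → i ∈ v ⊎ ∇ i x ≈ 0#) → Spanned v x
  monomial-spanning [] x e =
    -- With nothing pending, `x` is symmetric and serves itself as the coefficient of the empty
    -- monomial.
    1 , (λ _ → []) , (λ _ → x , affine-symmetric _ _ (proj₂ (proj₂ affine))) ,
    sym (trans (+-identityʳ _) (*-identityʳ x))
    where
    ∂≈∂ : ∀ i → ∂ (δ i) x ≈ ∂ (δ zero) x
    ∂≈∂ zero    = refl
    ∂≈∂ (suc i) with e i
    ... | inj₂ e′ = x∙y⁻¹≈ε⇒x≈y _ _ (trans (sym (∂-minus (δ (suc i)) (δ zero) x)) e′)
    affine : ∃ λ a → ∃ λ b → x ≈ con a + con b * F
    affine = ∂≈∂⇒affine ∂≈∂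
  monomial-spanning (i ∷ v) x e = spanned-cong
    (trans (extract-sum x i) (+-congʳ (sym (*-identityˡ _))))
    (spanned-+ (spanned-∷ false i (rec false)) (spanned-∷ true i (rec true)))
    where
    rec : ∀ b → Spanned v (extract b i x)
    rec b = monomial-spanning v (extract b i x) still
      where
      still : ∀ j → j ∈ v ⊎ ∇ j (extract b i x) ≈ 0#
      still j with e j
      ... | inj₁ (here ≡.refl) = inj₂ (∇-extract-same b i x)
      ... | inj₁ (there j∈v)   = inj₁ j∈v
      ... | inj₂ e′            = inj₂ (∇-extract b i e′)

  -- The variable `θ zero` is left out: over the symmetric elements it equals F minus the other
  -- variables.
  monomial-isBasis : IsBasis (R-over-Sym n) (monomial (allFin m))
  monomial-isBasis = record
    { spanning = λ x → monomial-spanning (allFin m) x (λ i → inj₁ (∈-allFin⁺ i))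
    ; independent = monomial-independent (tabulate⁺ id)
    }

  free : IsFree (R-over-Sym n)
  free = Vec Bool m , monomial (allFin m) , monomial-isBasis

-- The map from the tensor product back to the polynomial ring

module Retraction (m : ℕ) where
  private n = suc m
  open Superalgebra (R n) hiding (zero)
  open Derivations {n}
  open Shears {n}
  open Splitting m
  open IsForm
  open SetoidReasoning setoid
  private
    module S = Superalgebra (Sym n)
    module T = Algebra (R/J n ⊗ Sym n)
    module ⟨J⟩ = J n
    module H = Homogeneous
    module ≈⊗ = Tensor (R/J n) (Sym n)
  open ≈⊗ using (pure*)

  private module split = IsHom split-isHom

  split-F : split F ≈ 0#
  split-F = trans (+-congˡ (trans (*-congˡ (∂F zero)) (*-identityʳ _))) (-‿inverseʳ F)

  -- Applied to both `split` and `vanish`, this identifies their values on symmetric elements.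
  affine-image : ∀ {f} → IsHom algebra f → f F ≈ 0# → ∀ {x} a b →
    x ≈ con a + con b * F → f x ≈ con a
  affine-image {f} f-isHom fF≈0 {x} a b e = begin
    f x                         ≈⟨ f.cong e ⟩
    f (con a + con b * F)       ≈⟨ f.+-homo _ _ ⟩
    f (con a) + f (con b * F)   ≈⟨ +-cong (f.con-homo a) (trans (f.*-homo _ _) (trans (*-congˡ fF≈0) (zeroʳ _))) ⟩
    con a + 0#                  ≈⟨ +-identityʳ _ ⟩
    con a                       ∎
    where module f = IsHom f-isHom

  -- The disjunction is the form that passes through products: either both degrees are 0, or some
  -- factor vanishes.
  homogeneous-vanish : ∀ {d x} → Homogeneous d x → d ≡ 0 ⊎ vanish x ≈ 0#
  homogeneous-vanish (H.con q)    = inj₁ ≡.refl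
  homogeneous-vanish (H.θ i)      = inj₂ refl
  homogeneous-vanish H.zero       = inj₂ refl
  homogeneous-vanish (H.add h k)  = add (homogeneous-vanish h) (homogeneous-vanish k)
    where
    add : ∀ {d x y} → d ≡ 0 ⊎ x ≈ 0# → d ≡ 0 ⊎ y ≈ 0# → d ≡ 0 ⊎ x + y ≈ 0#
    add (inj₁ e) _        = inj₁ e
    add (inj₂ _) (inj₁ e) = inj₁ e
    add (inj₂ e) (inj₂ f) = inj₂ (trans (+-cong e f) (+-identityˡ 0#))
  homogeneous-vanish (H.mul h k)  = mul (homogeneous-vanish h) (homogeneous-vanish k)
    where
    mul : ∀ {d e x y} → d ≡ 0 ⊎ x ≈ 0# → e ≡ 0 ⊎ y ≈ 0# → d ℕ.+ e ≡ 0 ⊎ x * y ≈ 0#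
    mul (inj₁ e) (inj₁ f) = inj₁ (≡.cong₂ ℕ._+_ e f)
    mul (inj₁ _) (inj₂ f) = inj₂ (trans (*-congˡ f) (zeroʳ _))
    mul (inj₂ e) _        = inj₂ (trans (*-congʳ e) (zeroˡ _))
  homogeneous-vanish (H.neg h)    =
    Sum.map₂ (λ e → trans (-‿cong e) -0#≈0#) (homogeneous-vanish h)
  homogeneous-vanish (H.resp e h) =
    Sum.map₂ (trans (IsHom.cong vanish-isHom (sym e))) (homogeneous-vanish h)

  F-homogeneous : Homogeneous 1 F
  F-homogeneous = go θ H.θ
    where
    go : ∀ {k} (f : Fin k → Poly n) → (∀ i → Homogeneous 1 (f i)) → Homogeneous 1 (sum f)
    go {zero}  f h = H.zero
    go {suc k} f h = H.add (h zero) (go (f ∘ suc) (h ∘ suc))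

  vanish-F : vanish F ≈ 0#
  vanish-F = trans (reflexive (lift-sum θ)) (sum-replicate-zero n)
    where
    lift-sum : ∀ {k} (f : Fin k → Poly n) → vanish (sum f) ≡ sum (vanish ∘ f)
    lift-sum {zero}  f = ≡.refl
    lift-sum {suc k} f = ≡.cong (vanish (f zero) +_) (lift-sum (f ∘ suc))

  F∈J : ⟨J⟩.⟨ F ⟩
  F∈J = ⟨J⟩.gen (F-symmetric , 1 , (λ ()) , F-homogeneous)

  -- A generator has the form a + b F. Both `split` and `vanish` send it to a, and `vanish` sends it
  -- to 0 because its degree is nonzero.
  split-J : ∀ {x} → ⟨J⟩.⟨ x ⟩ → split x ≈ 0#
  split-J {x} (⟨J⟩.gen (s , d , d≢0 , h)) = go (symmetric⇒affine s)
    where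
    vanish≈0 : vanish x ≈ 0#
    vanish≈0 = Sum.[ (λ d≡0 → contradiction d≡0 d≢0) , id ] (homogeneous-vanish h)
    go : (∃ λ a → ∃ λ b → x ≈ con a + con b * F) → split x ≈ 0#
    go (a , b , e) = trans (affine-image split-isHom split-F a b e)
      (trans (sym (affine-image vanish-isHom vanish-F a b e)) vanish≈0)
  split-J ⟨J⟩.zero       = split.con-homo 0ℚ
  split-J (⟨J⟩.add i j)  = trans (split.+-homo _ _) (trans (+-cong (split-J i) (split-J j)) (+-identityˡ 0#))
  split-J (⟨J⟩.mulˡ x i) = trans (split.*-homo x _) (trans (*-congˡ (split-J i)) (zeroʳ _))
  split-J (⟨J⟩.mulʳ y i) = trans (split.*-homo _ y) (trans (*-congʳ (split-J i)) (zeroˡ _))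
  split-J (⟨J⟩.resp e i) = trans (split.cong (sym e)) (split-J i)

  split-∼ : ∀ {x y} → x ⟨J⟩.∼ y → split x ≈ split y
  split-∼ {x} {y} (⟨J⟩.mk i) = x∙y⁻¹≈ε⇒x≈y _ _ (trans (+-congˡ (sym (split.-‿homo y)))
    (trans (sym (split.+-homo x (- y))) (split-J i)))

  split-θ-form : ∀ i → IsForm (split (θ i))
  split-θ-form i = +-form (θ-form i) (scale-form (-‿form F-form) (δ zero i))

  -- The substitution sends each variable to an odd element, so it preserves parity.
  split-σ : ∀ x → split (σ x) ≈ σ (split x)
  split-σ = hom-ext algebra (∘-isHom split-isHom σ-isHom) (∘-isHom σ-isHom split-isHom) λ i → begin
    split (σ (θ i))    ≈⟨ split.cong (σ-θ i) ⟩
    split (- θ i)      ≈⟨ split.-‿homo (θ i) ⟩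
    - split (θ i)      ≈⟨ odd (split-θ-form i) ⟨
    σ (split (θ i))    ∎

  from : T.Carrier → Poly n
  from ≈⊗.0#         = 0#
  from (u ≈⊗.+ v)    = from u + from v
  from (≈⊗.- u)      = - from u
  from (a ≈⊗.⊗ₑ c)   = split a * proj₁ c

  from-cong : ∀ {u v} → u T.≈ v → from u ≈ from v
  from-cong ≈⊗.refl               = refl
  from-cong (≈⊗.sym e)            = sym (from-cong e)
  from-cong (≈⊗.trans e f)        = trans (from-cong e) (from-cong f)
  from-cong (≈⊗.+-cong e f)       = +-cong (from-cong e) (from-cong f)
  from-cong (≈⊗.-‿cong e)         = -‿cong (from-cong e)
  from-cong (≈⊗.+-assoc _ _ _)    = +-assoc _ _ _
  from-cong (≈⊗.+-comm _ _)       = +-comm _ _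
  from-cong (≈⊗.+-identityˡ _)    = +-identityˡ _
  from-cong (≈⊗.-‿inverseˡ _)     = -‿inverseˡ _
  from-cong (≈⊗.⊗-cong e f)       = *-cong (split-∼ e) f
  from-cong (≈⊗.⊗-distribʳ a b c) = trans (*-congʳ (split.+-homo a b)) (distribʳ _ _ _)
  from-cong (≈⊗.⊗-distribˡ a c d) = distribˡ _ _ _
  from-cong (≈⊗.⊗-balanced q a c) = begin
    split (con q * a) * proj₁ c           ≈⟨ *-congʳ (split.*-homo (con q) a) ⟩
    (split (con q) * split a) * proj₁ c  ≈⟨ *-congʳ (*-congʳ (split.con-homo q)) ⟩
    (con q * split a) * proj₁ c           ≈⟨ *-congʳ (ι-central q _) ⟩
    (split a * con q) * proj₁ c           ≈⟨ *-assoc _ _ _ ⟩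
    split a * (con q * proj₁ c)           ∎

  -- Together with `from-1⊗c-*` this is all the multiplicativity of `from` that is needed, since
  -- constants map to pure tensors a ⊗ 1 and the images of the variables are sums of tensors a ⊗ 1
  -- and 1 ⊗ c with c odd.
  from-a⊗1-* : ∀ a u → from (pure* a S.1# u) ≈ split a * from u
  from-a⊗1-* a ≈⊗.0#       = sym (zeroʳ _)
  from-a⊗1-* a (u ≈⊗.+ v)  = trans (+-cong (from-a⊗1-* a u) (from-a⊗1-* a v)) (sym (distribˡ _ _ _))
  from-a⊗1-* a (≈⊗.- u)    = trans (-‿cong (from-a⊗1-* a u)) (-‿distribʳ-* _ _)
  from-a⊗1-* a (b ≈⊗.⊗ₑ (c , _)) = begin
    split (a * b₀) * (1# * c) + split (a * b₁) * (σ 1# * c)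
      ≈⟨ +-cong (*-congˡ (*-identityˡ c)) (*-congˡ (trans (*-congʳ (σ-con 1ℚ)) (*-identityˡ c))) ⟩
    split (a * b₀) * c + split (a * b₁) * c
      ≈⟨ distribʳ _ _ _ ⟨
    (split (a * b₀) + split (a * b₁)) * c
      ≈⟨ *-congʳ (split.+-homo (a * b₀) (a * b₁)) ⟨
    split (a * b₀ + a * b₁) * c
      ≈⟨ *-congʳ (split.cong (trans (sym (distribˡ _ _ _)) (*-congˡ (part-sum b)))) ⟩
    split (a * b) * c
      ≈⟨ trans (*-congʳ (split.*-homo a b)) (*-assoc _ _ _) ⟩
    split a * (split b * c) ∎
    where
    b₀ = part 0ℙ b
    b₁ = part 1ℙ b

  -- The Koszul rule puts a minus sign on the odd part of `b`, which replaces `b` by `σ b`. This is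
  -- the sign needed to carry the odd `c` to the left of `split b`.
  from-1⊗c-* : ∀ (c : S.Carrier) → IsForm (proj₁ c) → ∀ u → from (pure* 1# c u) ≈ proj₁ c * from u
  from-1⊗c-* c C ≈⊗.0#       = sym (zeroʳ _)
  from-1⊗c-* c C (u ≈⊗.+ v)  = trans (+-cong (from-1⊗c-* c C u) (from-1⊗c-* c C v)) (sym (distribˡ _ _ _))
  from-1⊗c-* c C (≈⊗.- u)    = trans (-‿cong (from-1⊗c-* c C u)) (-‿distribʳ-* _ _)
  from-1⊗c-* (c , _) C (b ≈⊗.⊗ₑ (d , _)) = begin
    split (1# * b₀) * (c * d) + split (1# * b₁) * (σ c * d)
      ≈⟨ +-cong (trans (*-congʳ (split.cong (*-identityˡ b₀))) (sym (*-assoc _ _ _)))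
                (trans (*-cong (split.cong (*-identityˡ b₁)) (*-congʳ (odd C))) (sym (*-assoc _ _ _))) ⟩
    (split b₀ * c) * d + (split b₁ * - c) * d
      ≈⟨ distribʳ _ _ _ ⟨
    (split b₀ * c + split b₁ * - c) * d
      ≈⟨ *-congʳ (+-congˡ (trans (sym (-‿distribʳ-* _ _)) (-‿distribˡ-* _ _))) ⟩
    (split b₀ * c + - split b₁ * c) * d
      ≈⟨ *-congʳ (distribʳ _ _ _) ⟨
    ((split b₀ - split b₁) * c) * d
      ≈⟨ *-congʳ (*-congʳ (trans (split.+-homo b₀ (- b₁)) (+-congˡ (split.-‿homo b₁)))) ⟨
    (split (σ b) * c) * d
      ≈⟨ *-congʳ (*-congʳ (split-σ b)) ⟩
    (σ (split b) * c) * d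
      ≈⟨ *-congʳ (*-swap (split b) C) ⟨
    (c * split b) * d
      ≈⟨ *-assoc _ _ _ ⟩
    c * (split b * d) ∎
    where
    b₀ = part 0ℙ b
    b₁ = part 1ℙ b

-- The homomorphism into the tensor product and the isomorphism

module Section (m : ℕ) where
  private n = suc m
  open Derivations {n} using (σ; σ-θ; con-cong)
  open Shears {n}
  open Splitting m
  open IsForm
  open Retraction m
  private
    module R = Superalgebra (R n)
    module R/J = Superalgebra (R/J n)
    module S = Superalgebra (Sym n)
    module ⟨J⟩ = J n
    module ≈⊗ = Tensor (R/J n) (Sym n)
  open Algebra (R/J n ⊗ Sym n) hiding (zero)
  open RingProperties ring
  open ≈⊗
    using (_⊗ₑ_; ⊗-cong; ⊗-distribˡ; ⊗-distribʳ; ⊗-balanced; ⊗-zeroˡ; ⊗-negˡ)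
  open SetoidReasoning setoid

  ⊗-congˡ : ∀ {a c d} → c S.≈ d → a ⊗ₑ c ≈ a ⊗ₑ d
  ⊗-congˡ = ⊗-cong R/J.refl

  ⊗-congʳ : ∀ {a b c} → a R.≈ b → a ⊗ₑ c ≈ b ⊗ₑ c
  ⊗-congʳ e = ⊗-cong (⟨J⟩.≈⇒∼ e) R.refl

  ⊗-zeroʳ : ∀ a → a ⊗ₑ S.0# ≈ 0#
  ⊗-zeroʳ a = x+x≈x⇒x≈0 _ (trans (sym (⊗-distribˡ a S.0# S.0#)) (⊗-congˡ (R.+-identityˡ R.0#)))

  ⊗-negʳ : ∀ a c → a ⊗ₑ (S.- c) ≈ - (a ⊗ₑ c)
  ⊗-negʳ a c = +-inverseʳ-unique _ _ (begin
    a ⊗ₑ c + a ⊗ₑ (S.- c)   ≈⟨ ⊗-distribˡ a c (S.- c) ⟨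
    a ⊗ₑ (c S.- c)          ≈⟨ ⊗-congˡ (S.-‿inverseʳ c) ⟩
    a ⊗ₑ S.0#               ≈⟨ ⊗-zeroʳ a ⟩
    0#                      ∎)

  left : Poly n → Carrier
  left a = a ⊗ₑ S.1#

  right : S.Carrier → Carrier
  right c = R.1# ⊗ₑ c

  left-*-⊗ : ∀ a b c → left a * (b ⊗ₑ c) ≈ (a R.* b) ⊗ₑ c
  left-*-⊗ a b c = begin
    (a R.* R.part 0ℙ b) ⊗ₑ (S.1# S.* c) + (a R.* R.part 1ℙ b) ⊗ₑ (S.sign 1ℙ S.1# S.* c)
      ≈⟨ +-cong (⊗-congˡ (S.*-identityˡ c))
                (⊗-congˡ (R.trans (R.*-congʳ (R.sign-ι 1ℙ 1ℚ)) (S.*-identityˡ c))) ⟩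
    (a R.* R.part 0ℙ b) ⊗ₑ c + (a R.* R.part 1ℙ b) ⊗ₑ c
      ≈⟨ ⊗-distribʳ _ _ c ⟨
    (a R.* R.part 0ℙ b R.+ a R.* R.part 1ℙ b) ⊗ₑ c
      ≈⟨ ⊗-congʳ (R.trans (R.sym (R.distribˡ a _ _)) (R.*-congˡ (R.part-sum b))) ⟩
    (a R.* b) ⊗ₑ c ∎

  left-right : ∀ a c → left a * right c ≈ a ⊗ₑ c
  left-right a c = trans (left-*-⊗ a R.1# c) (⊗-congʳ (R.*-identityʳ a))

  -- The Koszul sign, for `a` of mixed parity: an odd `c` passing `a` turns it into `σ a`.
  right-left : ∀ a (c : S.Carrier) → IsForm (proj₁ c) → right c * left a ≈ σ a ⊗ₑ c
  right-left a c C = begin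
    (R.1# R.* a₀) ⊗ₑ (c S.* S.1#) + (R.1# R.* a₁) ⊗ₑ (S.sign 1ℙ c S.* S.1#)
      ≈⟨ +-cong (⊗-cong (⟨J⟩.≈⇒∼ (R.*-identityˡ a₀)) (S.*-identityʳ c))
                (⊗-cong (⟨J⟩.≈⇒∼ (R.*-identityˡ a₁)) (R.trans (R.*-identityʳ (σ (proj₁ c))) (odd C))) ⟩
    a₀ ⊗ₑ c + a₁ ⊗ₑ (S.- c)
      ≈⟨ +-congˡ (trans (⊗-negʳ a₁ c) (sym (⊗-negˡ a₁ c))) ⟩
    a₀ ⊗ₑ c + (R.- a₁) ⊗ₑ c
      ≈⟨ ⊗-distribʳ a₀ (R.- a₁) c ⟨
    σ a ⊗ₑ c ∎
    where
    a₀ = R.part 0ℙ a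
    a₁ = R.part 1ℙ a

  right-right : ∀ c d → right c * right d ≈ right (c S.* d)
  right-right c d = trans
    (+-cong (⊗-congʳ (R.*-identityˡ R.1#))
      (trans (⊗-congʳ (R.zeroʳ R.1#)) (⊗-zeroˡ _)))
    (+-identityʳ _)

  left-isHom : IsHom (R/J n ⊗ Sym n) left
  left-isHom = record
    { cong     = ⊗-congʳ
    ; +-homo   = λ a b → ⊗-distribʳ a b S.1#
    ; *-homo   = λ a b → sym (left-*-⊗ a b S.1#)
    ; -‿homo   = λ a → ⊗-negˡ a S.1#
    ; con-homo = λ _ → refl
    }

  right-ι : ∀ q → right (S.ι q) ≈ ι q
  right-ι q = begin
    R.1# ⊗ₑ S.ι q              ≈⟨ ⊗-congˡ (S.*-identityʳ (S.ι q)) ⟨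
    R.1# ⊗ₑ (S.ι q S.* S.1#)   ≈⟨ ⊗-balanced q R.1# S.1# ⟨
    (con q R.* R.1#) ⊗ₑ S.1#   ≈⟨ ⊗-congʳ (R.*-identityʳ (con q)) ⟩
    ι q                        ∎

  right-ι* : ∀ q c → right (S.ι q S.* c) ≈ ι q * right c
  right-ι* q c = trans (sym (right-right (S.ι q) c)) (*-congʳ {right c} (right-ι q))

  Fₛ : S.Carrier
  Fₛ = F , F-symmetric

  -- The symmetric component of the image of a variable; the zero entries allow all variables to be
  -- treated uniformly in `t`.
  weight : Fin n → S.Carrier
  weight zero    = Fₛ
  weight (suc _) = S.0#

  weight-form : ∀ i → IsForm (proj₁ (weight i))
  weight-form zero    = F-form
  weight-form (suc _) = 0-form

  weight-* : ∀ i j → weight i S.* weight j S.≈ S.0#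
  weight-* zero    zero    = square F-form
  weight-* zero    (suc _) = R.zeroʳ F
  weight-* (suc _) j       = R.zeroˡ _

  split-θ+weight : ∀ i → split (θ i) R.+ proj₁ (weight i) R.≈ θ i
  split-θ+weight i = R.trans (R.+-assoc _ _ _) (R.trans (R.+-congˡ (cancel i)) (R.+-identityʳ _))
    where
    cancel : ∀ i → R.- F R.* con (δ zero i) R.+ proj₁ (weight i) R.≈ R.0#
    cancel zero    = R.trans (R.+-congʳ (R.*-identityʳ _)) (R.-‿inverseˡ F)
    cancel (suc _) = R.trans (R.+-identityʳ _) (R.zeroʳ _)

  t : Fin n → Carrier
  t i = left (θ i) + right (weight i)

  -- In this form anticommutation is visible, since the bracket is antisymmetric in `i` and `j`. The
  -- product of the two weights is absent because F² = 0.
  t-* : ∀ i j → t i * t j ≈ left (θ i R.* θ j) + (θ i ⊗ₑ weight j - θ j ⊗ₑ weight i)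
  t-* i j = begin
    t i * t j
      ≈⟨ distribˡ (t i) (left (θ j)) (right (weight j)) ⟩
    t i * left (θ j) + t i * right (weight j)
      ≈⟨ +-cong (distribʳ (left (θ j)) (left (θ i)) (right (weight i)))
                (distribʳ (right (weight j)) (left (θ i)) (right (weight i))) ⟩
    (left (θ i) * left (θ j) + right (weight i) * left (θ j)) +
    (left (θ i) * right (weight j) + right (weight i) * right (weight j))
      ≈⟨ +-cong (+-cong (left-*-⊗ (θ i) (θ j) S.1#) swapped)
                (+-cong (left-right (θ i) (weight j)) vanishing) ⟩
    (left (θ i R.* θ j) - θ j ⊗ₑ weight i) + (θ i ⊗ₑ weight j + 0#)
      ≈⟨ +-congˡ (+-identityʳ _) ⟩
    (left (θ i R.* θ j) - θ j ⊗ₑ weight i) + θ i ⊗ₑ weight j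
      ≈⟨ trans (+-assoc _ _ _) (+-congˡ (+-comm _ _)) ⟩
    left (θ i R.* θ j) + (θ i ⊗ₑ weight j - θ j ⊗ₑ weight i) ∎
    where
    swapped : right (weight i) * left (θ j) ≈ - (θ j ⊗ₑ weight i)
    swapped = trans (right-left (θ j) (weight i) (weight-form i))
      (trans (⊗-congʳ (σ-θ j)) (⊗-negˡ (θ j) (weight i)))
    vanishing : right (weight i) * right (weight j) ≈ 0#
    vanishing = trans (right-right (weight i) (weight j))
      (trans (⊗-congˡ (weight-* i j)) (⊗-zeroʳ R.1#))

  t-anticomm : ∀ i j → t i * t j ≈ - (t j * t i)
  t-anticomm i j = begin
    t i * t j
      ≈⟨ t-* i j ⟩
    left (θ i R.* θ j) + (θ i ⊗ₑ weight j - θ j ⊗ₑ weight i)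
      ≈⟨ +-cong (trans (⊗-congʳ θ-anticomm) (⊗-negˡ (θ j R.* θ i) S.1#)) (sym (⁻¹-anti-homo‿- _ _)) ⟩
    - left (θ j R.* θ i) - (θ j ⊗ₑ weight i - θ i ⊗ₑ weight j)
      ≈⟨ -‿+-comm _ _ ⟩
    - (left (θ j R.* θ i) + (θ j ⊗ₑ weight i - θ i ⊗ₑ weight j))
      ≈⟨ -‿cong (t-* j i) ⟨
    - (t j * t i) ∎
    where
    θ-anticomm : θ i R.* θ j R.≈ R.- (θ j R.* θ i)
    θ-anticomm = R.trans (swap (θ-form j) (θ i))
      (R.trans (R.*-congˡ (σ-θ i)) (R.sym (R.-‿distribʳ-* _ _)))

  open Lift (R/J n ⊗ Sym n) t t-anticomm public
    using () renaming (lift to to; lift-cong to to-cong; lift-isHom to to-isHom)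

  -- Carrying an arbitrary right factor `u` lets the induction on `x` pass through products without
  -- `from` being known to be multiplicative; `u` equal to 1 gives `from-to`.
  from-to-* : ∀ x u → from (to x * u) R.≈ x R.* from u
  from-to-* (con q)  u = R.trans (from-a⊗1-* (con q) u)
    (R.*-congʳ (IsHom.con-homo split-isHom q))
  from-to-* (θ i)    u = R.trans
    (R.+-cong (from-a⊗1-* (θ i) u) (from-1⊗c-* (weight i) (weight-form i) u))
    (R.trans (R.sym (R.distribʳ _ _ _)) (R.*-congʳ (split-θ+weight i)))
  from-to-* (x +ᴿ y) u = R.trans (R.+-cong (from-to-* x u) (from-to-* y u)) (R.sym (R.distribʳ _ x y))
  from-to-* (x *ᴿ y) u = R.trans (from-cong (*-assoc (to x) (to y) u))
    (R.trans (from-to-* x (to y * u)) (R.trans (R.*-congˡ (from-to-* y u)) (R.sym (R.*-assoc x y _))))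
  from-to-* (-ᴿ x)   u = R.trans (R.-‿cong (from-to-* x u)) (R.-‿distribˡ-* x _)

  from-to : ∀ x → from (to x) R.≈ x
  from-to x = R.trans (from-cong (sym (*-identityʳ (to x)))) (R.trans (from-to-* x 1#)
    (R.trans (R.*-congˡ (R.trans (R.*-identityʳ _) (IsHom.con-homo split-isHom 1ℚ))) (R.*-identityʳ x)))

  -- Summing the images of the variables gives F ⊗ 1 + 1 ⊗ F, and F is zero in the quotient.
  to-F : to F ≈ right Fₛ
  to-F = begin
    (left (θ zero) + right Fₛ) + to (sum (θ ∘ suc))   ≈⟨ +-congˡ (to-sum id) ⟩
    (left (θ zero) + right Fₛ) + left (sum (θ ∘ suc)) ≈⟨ trans (+-congʳ (+-comm _ _)) (+-assoc _ _ _) ⟩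
    right Fₛ + (left (θ zero) + left (sum (θ ∘ suc))) ≈⟨ +-congˡ (⊗-distribʳ (θ zero) (sum (θ ∘ suc)) S.1#) ⟨
    right Fₛ + left F                                 ≈⟨ +-congˡ (⊗-cong F∼0 R.refl) ⟩
    right Fₛ + R.0# ⊗ₑ S.1#                           ≈⟨ +-congˡ (⊗-zeroˡ S.1#) ⟩
    right Fₛ + 0#                                     ≈⟨ +-identityʳ _ ⟩
    right Fₛ                                          ∎
    where
    F∼0 : F ⟨J⟩.∼ R.0#
    F∼0 = ⟨J⟩.mk (⟨J⟩.resp (R.sym (R.trans (R.+-congˡ R.-0#≈0#) (R.+-identityʳ F))) F∈J)
    -- The general `f` keeps the induction hypothesis applicable after the indices are shifted by
    -- `suc`.
    to-sum : ∀ {k} (f : Fin k → Fin m) → to (sum (θ ∘ suc ∘ f)) ≈ left (sum (θ ∘ suc ∘ f))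
    to-sum {zero}  f = refl
    to-sum {suc k} f = trans
      (+-cong (trans (+-congˡ (⊗-zeroʳ R.1#)) (+-identityʳ _)) (to-sum (f ∘ suc)))
      (sym (⊗-distribʳ (θ (suc (f zero))) (sum (θ ∘ suc ∘ f ∘ suc)) S.1#))

  -- By `symmetric⇒affine` it suffices to know the images of constants and of F.
  to-symmetric : ∀ (c : S.Carrier) → to (proj₁ c) ≈ right c
  to-symmetric (c , s) = go (symmetric⇒affine s)
    where
    go : (∃ λ a → ∃ λ b → c R.≈ con a R.+ con b R.* F) → to c ≈ right (c , s)
    go (a , b , e) = begin
      to c                                    ≈⟨ to-cong e ⟩
      ι a + ι b * to F                        ≈⟨ +-cong (sym (right-ι a)) (*-congˡ {ι b} to-F) ⟩
      right (S.ι a) + ι b * right Fₛ          ≈⟨ +-congˡ (right-ι* b Fₛ) ⟨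
      right (S.ι a) + right (S.ι b S.* Fₛ)    ≈⟨ ⊗-distribˡ R.1# (S.ι a) (S.ι b S.* Fₛ) ⟨
      right (S.ι a S.+ S.ι b S.* Fₛ)          ≈⟨ ⊗-congˡ e ⟨
      right (c , s)                           ∎

  -- On `θ zero` the summand 1 ⊗ F of its image cancels against the image of the F subtracted by
  -- `split`; the other variables carry neither term.
  to-split : ∀ x → to (split x) ≈ left x
  to-split = hom-ext (R/J n ⊗ Sym n) (∘-isHom to-isHom split-isHom) left-isHom λ i → begin
    t i + - to F * ι (δ zero i)           ≈⟨ +-assoc _ _ _ ⟩
    left (θ i) + (right (weight i) + - to F * ι (δ zero i))
                                          ≈⟨ +-congˡ (trans (+-congˡ (*-congʳ (-‿cong to-F))) (cancel i)) ⟩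
    left (θ i) + 0#                       ≈⟨ +-identityʳ _ ⟩
    left (θ i)                            ∎
    where
    cancel : ∀ i → right (weight i) + - right Fₛ * ι (δ zero i) ≈ 0#
    cancel zero    = trans (+-congˡ (*-identityʳ _)) (-‿inverseʳ _)
    cancel (suc _) = trans
      (+-cong (⊗-zeroʳ R.1#) (trans (*-congˡ { - right Fₛ} (⊗-zeroˡ S.1#)) (zeroʳ (- right Fₛ))))
      (+-identityʳ 0#)

  to-from : ∀ u → to (from u) ≈ u
  to-from ≈⊗.0#       = ⊗-zeroˡ S.1#
  to-from (u ≈⊗.+ v)  = +-cong (to-from u) (to-from v)
  to-from (≈⊗.- u)    = -‿cong (to-from u)
  to-from (a ≈⊗.⊗ₑ c) = begin
    to (split a) * to (proj₁ c)  ≈⟨ *-cong (to-split a) (to-symmetric c) ⟩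
    left a * right c              ≈⟨ left-right a c ⟩
    a ⊗ₑ c                        ∎

  R≅R/J⊗Sym : Superalgebra.algebra (R n) ≅ R/J n ⊗ Sym n
  R≅R/J⊗Sym = record
    { to = to
    ; isRingIsomorphism = record
      { isRingMonomorphism = record
        { isRingHomomorphism = record
          { isSemiringHomomorphism = record
            { isNearSemiringHomomorphism = record
              { +-isMonoidHomomorphism = record
                { isMagmaHomomorphism = record
                  { isRelHomomorphism = record { cong = to-cong }
                  ; homo = λ _ _ → refl }
                ; ε-homo = ⊗-zeroˡ S.1# }
              ; *-homo = λ _ _ → refl }
            ; 1#-homo = refl }
          ; -‿homo = λ _ → refl }
        ; injective = λ {x} {y} e → R.trans (R.sym (from-to x)) (R.trans (from-cong e) (from-to y)) }
      ; surjective = λ u → from u , λ e → trans (to-cong e) (to-from u) }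
    ; ι-homo = λ _ → refl
    }

proposition2p5 : (n : ℕ) .{{_ : NonZero n}} →
    (Superalgebra.algebra (R n) ≅ R/J n ⊗ Sym n) × IsFree (R-over-Sym n)
proposition2p5 zero    = contradiction ≡.refl (≢-nonZero⁻¹ 0)
proposition2p5 (suc m) = Section.R≅R/J⊗Sym m , Freeness.free m
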